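{- In the hybrid setting, there does not exist an algorithm that, for every instance $(U,w)$ with $|U|=n$, takes $m=o(\min(\sqrt[3]{n}/\varepsilon^{4/3},n))$ proportional and uniform samples and returns a $(1\pm\varepsilon)$-approximation of $W$ with probability $2/3$. This holds also when $n$ is known to the algorithm.
   Context: An instance $(U,w)$ consists of a finite set $U$ and a weight function $w:U\to[0,\infty)$; $W=\sum_{a\in U}w(a)$. The approximation parameter $\varepsilon$ satisfies $0<\varepsilon<1$. A value $\hat W$ is a $(1\pm\varepsilon)$-approximation of $W$ if $(1-\varepsilon)W\le\hat W\le(1+\varepsilon)W$. The asymptotic notation is for the limit $n\to\infty$, and makes sense also for constant $\varepsilon$. Hybrid setting: the algorithm can interact with the items only by (1) proportionally sampling an item, which returns $(a,w(a))$ with probability $w(a)/W$; (2) given two items $a,a'$, checking whether $a=a'$; (3) sampling an item uniformly, which returns $(a,w(a))$ for any $a\in U$ with probability $1/n$.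
   Formalization: The parameter ε may depend on n but is required to stay below a fixed constant less than 1; without this the claim fails, since for ε = 1 − 1/(3n) a single proportional sample already gives a (1±ε)-approximation with probability 2/3. -}

module Defs where

open import Level using (Level; _⊔_; suc)
open import Algebra.Bundles using (CommutativeRing)
open import Data.Bool.Base using (Bool; if_then_else_)
open import Data.Fin.Base using (Fin)
import Data.Fin.Properties as Fin
open import Data.Nat.Base as ℕ using (ℕ)
open import Data.Product using (_×_; ∃-syntax; Σ-syntax)
open import Data.Vec.Base using (Vec; []; _∷_; lookup)
open import Relation.Binary using (Rel; DecTotalOrder; IsDecTotalOrder)
open import Relation.Nullary using (¬_; Dec; does)
open import Relation.Nullary.Decidable using (_×-dec_)
import Algebra.Construct.NaturalChoice.Min as Min
import Algebra.Properties.Monoid.Mult as Mult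
import Algebra.Properties.Monoid.Sum as Sum
import Algebra.Properties.Semiring.Exp as Exp

-- The axioms of ℝ that are needed to state results about real weights, real
-- probabilities and cube roots. Classically ℝ is a model
-- (decidability of the order is excluded middle). Completeness is not
-- required, so a theorem about every `RealField` is in particular one about ℝ.
-- The value of 0# ⁻¹ is unconstrained.
record RealField c ℓ₁ ℓ₂ : Set (suc (c ⊔ ℓ₁ ⊔ ℓ₂)) where
  infix  4 _≤_ _<_
  infix  8 _⁻¹
  infixl 7 _/_

  field
    commutativeRing : CommutativeRing c ℓ₁

  open CommutativeRing commutativeRing public
  open Exp semiring public using (_^_)
  open Sum +-monoid public using (sum)

  fromℕ : ℕ → Carrier
  fromℕ n = Mult._×_ +-monoid n 1#

  field
    _≤_             : Rel Carrier ℓ₂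
    isDecTotalOrder : IsDecTotalOrder _≈_ _≤_
    +-monoˡ-≤       : ∀ z {x y} → x ≤ y → x + z ≤ y + z
    *-nonNegative   : ∀ {x y} → 0# ≤ x → 0# ≤ y → 0# ≤ x * y
    0≉1             : ¬ 0# ≈ 1#
    _⁻¹             : Carrier → Carrier
    *-inverseʳ      : ∀ x → ¬ x ≈ 0# → x * x ⁻¹ ≈ 1#
    archimedean     : ∀ x → ∃[ n ] x ≤ fromℕ n
    ∛               : Carrier → Carrier
    ∛-cubed         : ∀ x → ∛ x ^ 3 ≈ x

  decTotalOrder : DecTotalOrder c ℓ₁ ℓ₂
  decTotalOrder = record { isDecTotalOrder = isDecTotalOrder }

  open IsDecTotalOrder isDecTotalOrder public using (_≤?_)
  open Min (DecTotalOrder.totalOrder decTotalOrder) public using (_⊓_)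

  _<_ : Rel Carrier (ℓ₁ ⊔ ℓ₂)
  x < y = x ≤ y × ¬ x ≈ y

  _/_ : Carrier → Carrier → Carrier
  x / y = x * y ⁻¹

module Hybrid {c ℓ₁ ℓ₂} (R : RealField c ℓ₁ ℓ₂) where
  open RealField R

  infix 4 _=o_

  -- Little-o as n → ∞, for nonnegative sequences.
  _=o_ : (ℕ → Carrier) → (ℕ → Carrier) → Set (c ⊔ ℓ₁ ⊔ ℓ₂)
  f =o g = ∀ δ → 0# < δ → ∃[ N ] (∀ n → N ℕ.≤ n → f n ≤ δ * g n)

  -- min (∛n / ε^(4/3), n)
  threshold : ℕ → Carrier → Carrier
  threshold n ε = (∛ (fromℕ n) / ∛ (ε ^ 4)) ⊓ fromℕ n

  -- Proportional sampling is only meaningful when the total weight is nonzero.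
  record Instance (n : ℕ) : Set (c ⊔ ℓ₁ ⊔ ℓ₂) where
    field
      weight             : Fin n → Carrier
      weight-nonNegative : ∀ a → 0# ≤ weight a

    W : Carrier
    W = sum weight

    field
      W-positive : 0# < W

  -- A deterministic algorithm that draws at most m further samples and already
  -- holds k sampled items. Items are opaque: they are referred to by their
  -- position among the samples drawn so far (position 0 being the most recent
  -- one), the continuation of a sample receives only the weight of the item,
  -- and items can be tested for equality at no cost.
  data Algorithm : (m k : ℕ) → Set c where
    output       : ∀ {m k} → Carrier → Algorithm m k
    proportional : ∀ {m k} → (Carrier → Algorithm m (ℕ.suc k)) →
                   Algorithm (ℕ.suc m) k
    uniform      : ∀ {m k} → (Carrier → Algorithm m (ℕ.suc k)) →
                   Algorithm (ℕ.suc m) k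
    compare      : ∀ {m k} → Fin k → Fin k → (Bool → Algorithm m k) →
                   Algorithm m k

  module _ {n} (I : Instance n) (ε : Carrier) where
    open Instance I

    IsApproximation : Carrier → Set ℓ₂
    IsApproximation Ŵ = (1# - ε) * W ≤ Ŵ × Ŵ ≤ (1# + ε) * W

    isApproximation? : ∀ Ŵ → Dec (IsApproximation Ŵ)
    isApproximation? Ŵ = ((1# - ε) * W ≤? Ŵ) ×-dec (Ŵ ≤? (1# + ε) * W)

    -- Probability, over the samples still to be drawn, that the output is a
    -- (1 ± ε)-approximation of W, given the items drawn so far.
    successProbability : ∀ {m k} → Algorithm m k → Vec (Fin n) k → Carrier
    successProbability (output Ŵ) items =
      if does (isApproximation? Ŵ) then 1# else 0#
    successProbability (proportional next) items =
      sum λ a → weight a / W * successProbability (next (weight a)) (a ∷ items)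
    successProbability (uniform next) items =
      sum λ a → 1# / fromℕ n * successProbability (next (weight a)) (a ∷ items)
    successProbability (compare i j next) items =
      successProbability
        (next (does (lookup items i Fin.≟ lookup items j))) items

  -- A source of randomness, given by its expectation operator. Every
  -- probability space in the measure-theoretic sense is one, with `Integrable`
  -- and `𝔼` the usual notions. `𝔼 f` carries information only when `f` is
  -- integrable.
  record RandomSource s : Set (c ⊔ ℓ₁ ⊔ ℓ₂ ⊔ suc s) where
    field
      Ω          : Set s
      Integrable : (Ω → Carrier) → Set s
      𝔼          : (Ω → Carrier) → Carrier

      const-integrable : ∀ x → Integrable (λ _ → x)
      +-integrable     : ∀ {f g} → Integrable f → Integrable g →
                         Integrable (λ ω → f ω + g ω)
      *-integrable     : ∀ x {f} → Integrable f → Integrable (λ ω → x * f ω)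

      𝔼-const : ∀ x → 𝔼 (λ _ → x) ≈ x
      𝔼-+     : ∀ {f g} → Integrable f → Integrable g →
                𝔼 (λ ω → f ω + g ω) ≈ 𝔼 f + 𝔼 g
      𝔼-*     : ∀ x {f} → Integrable f → 𝔼 (λ ω → x * f ω) ≈ x * 𝔼 f
      𝔼-mono  : ∀ {f g} → Integrable f → Integrable g →
                (∀ ω → f ω ≤ g ω) → 𝔼 f ≤ 𝔼 g

  -- The internal randomness is drawn in advance, independently of the samples.
  record RandomizedAlgorithm s (m : ℕ) : Set (c ⊔ ℓ₁ ⊔ ℓ₂ ⊔ suc s) where
    field
      source : RandomSource s

    open RandomSource source public

    field
      run : Ω → Algorithm m 0

  -- A returns a (1 ± ε)-approximation of W with probability at least 2/3.
  -- Integrability is the measurability of the success event.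
  Succeeds : ∀ {s m n} → RandomizedAlgorithm s m → Carrier → Instance n →
             Set (ℓ₂ ⊔ s)
  Succeeds A ε I =
    Integrable success × fromℕ 2 / fromℕ 3 ≤ 𝔼 success
    where
    open RandomizedAlgorithm A
    success : Ω → Carrier
    success ω = successProbability I ε (run ω) []

{-# OPTIONS --safe #-}

-- Le Cam's two-point method. Both instances have weights in {0, 1}; the first has h heavy items,
-- the second has d = O(ε h) further "extra" ones, which is enough to make the two sets of
-- admissible answers disjoint. Uniform samples see the difference only through the proportion
-- of new heavy items and proportional samples only through the rate of collisions, so the
-- χ²-divergence grows by O(d²/(n h) + d² m/h³) per sample. For h ≈ (n/ε)^(2/3) the total over
-- m samples is small as long as m is small compared to n^(1/3)/ε^(4/3); if ε < n^(-1/2), then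
-- the same choice made for n^(-1/2) in place of ε gives the bound n.
--
-- As items are opaque, the extra items can be traded for new light items in the first instance
-- and for new heavy items in the second one. This couples the two executions so that they hold
-- the same items, none of them extra, and the likelihood ratio is tracked by induction over the
-- algorithm.
module Submission where

open import Defs
import Algebra.Construct.NaturalChoice.Min as Min
import Algebra.Properties.Ring as RingProperties
import Algebra.Properties.Semiring.Exp as Exp
import Algebra.Properties.Semiring.Mult as SemiringMult
import Algebra.Properties.Semiring.Mult.TCOptimised as SemiringMult′
import Algebra.Properties.Semiring.Sum as SemiringSum
import Algebra.Solver.Ring as RingSolver
open import Algebra.Solver.Ring.AlmostCommutativeRing
  using (fromCommutativeRing; _-Raw-AlmostCommutative⟶_)
open import Data.Bool.Base using (Bool; true; false; if_then_else_)
open import Data.Empty using (⊥; ⊥-elim)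
open import Data.Fin.Base as Fin using (Fin)
open import Data.Fin.Permutation using (Permutation′; _⟨$⟩ʳ_; _⟨$⟩ˡ_; transpose; inverseˡ)
import Data.Fin.Permutation.Components as Components
import Data.Fin.Properties as Fin
open import Data.Integer.Base as ℤ using (ℤ; +_; -[1+_])
import Data.Integer.Properties as ℤ
import Data.Maybe.Base as Maybe
open import Data.Nat.Base as ℕ using (ℕ; zero; suc)
import Data.Nat.Properties as ℕ
open import Data.Product using (_×_; _,_; proj₁; proj₂; Σ-syntax; ∃-syntax)
import Data.Sign.Base as Sign
open import Data.Sum.Base using (_⊎_; inj₁; inj₂; map₁)
open import Data.Vec.Base using (Vec; []; _∷_; lookup; map)
import Data.Vec.Membership.DecPropositional as DecMembership
open import Data.Vec.Membership.Propositional using (_∉_)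
open import Data.Vec.Properties using (lookup-map)
open import Data.Vec.Relation.Unary.All as All using (All; []; _∷_)
open import Data.Vec.Relation.Unary.Any using (here; there)
open import Function.Base using (_∘_)
open import Relation.Binary using (IsDecTotalOrder; DecTotalOrder)
open import Relation.Binary.PropositionalEquality as ≡ using (_≡_; _≢_)
open import Relation.Nullary using (¬_; yes; no; does; Dec)
open import Relation.Nullary.Decidable using (dec⇒maybe; dec-true; dec-false)

-- Samples drawn adaptively cannot be treated as independent, and total variation does not multiply
-- along a history. A second moment does: each sample multiplies it by at most `1 + x`, with the
-- same `x` for every history, so it survives an induction over the algorithm. Hence `max (1, L)`,
-- for the likelihood ratio `L`, is replaced by a quadratic in `L`, and the triple `(a, b, c)` of
-- `Bound` stands for `(a, a L, a L²)`, which avoids dividing by likelihoods that may vanish. An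
-- extra item shows weight 0 in one instance and 1 in the other, so after drawing it the two
-- executions would continue in different subtrees. Trading it for a new item of the weight it shows
-- keeps them in the same subtree; all that remains is a small difference between the laws of the
-- samples. Only one `n` is refuted for given `ε` and `m`. It is a constant times the sixth power of
-- a power of two, so that `h` and `d` are, up to constants, monomials in integers `Q` and `G`, and
-- nothing has to be rounded.

-- A ring solver with integer coefficients

module IntegerCoefficients {c ℓ₁ ℓ₂} (R : RealField c ℓ₁ ℓ₂) where
  open RealField R
  open import Relation.Binary.Reasoning.Setoid setoid
  open RingProperties ring using (-0#≈0#; -‿distribˡ-*; -‿distribʳ-*; -‿involutive; -‿+-comm)
  open SemiringMult′ semiring using (×-homo-+; ×1-homo-*; 1+×) renaming (_×_ to _×′_)

  -- With the optimised multiple, `con (+ 1)` denotes `1#` itself rather than `1# + 0#`.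
  fromℤ : ℤ → Carrier
  fromℤ (+ n)    = n ×′ 1#
  fromℤ -[1+ n ] = - (suc n ×′ 1#)

  fromℤ-⊖ : ∀ m n → fromℤ (m ℤ.⊖ n) ≈ m ×′ 1# - n ×′ 1#
  fromℤ-⊖ zero    zero    = sym (-‿inverseʳ 0#)
  fromℤ-⊖ zero    (suc n) = sym (+-identityˡ _)
  fromℤ-⊖ (suc m) zero    = begin
    suc m ×′ 1#        ≈⟨ +-identityʳ _ ⟨
    suc m ×′ 1# + 0#   ≈⟨ +-congˡ -0#≈0# ⟨
    suc m ×′ 1# - 0#   ∎
  fromℤ-⊖ (suc m) (suc n) = begin
    fromℤ (suc m ℤ.⊖ suc n)                    ≡⟨ ≡.cong fromℤ (ℤ.[1+m]⊖[1+n]≡m⊖n m n) ⟩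
    fromℤ (m ℤ.⊖ n)                            ≈⟨ fromℤ-⊖ m n ⟩
    m ×′ 1# - n ×′ 1#                          ≈⟨ +-congʳ (+-identityʳ _) ⟨
    m ×′ 1# + 0# - n ×′ 1#                     ≈⟨ +-congʳ (+-congˡ (-‿inverseʳ 1#)) ⟨
    m ×′ 1# + (1# - 1#) - n ×′ 1#              ≈⟨ +-congʳ (+-assoc _ _ _) ⟨
    m ×′ 1# + 1# - 1# - n ×′ 1#                ≈⟨ +-assoc _ _ _ ⟩
    m ×′ 1# + 1# + (- 1# - n ×′ 1#)            ≈⟨ +-cong (+-comm _ _) (-‿+-comm _ _) ⟩
    1# + m ×′ 1# - (1# + n ×′ 1#)              ≈⟨ +-cong (1+× m 1#) (-‿cong (1+× n 1#)) ⟨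
    suc m ×′ 1# - suc n ×′ 1#                  ∎

  fromℤ-neg : ∀ i → fromℤ (ℤ.- i) ≈ - fromℤ i
  fromℤ-neg (+ zero)  = sym -0#≈0#
  fromℤ-neg (+ suc n) = refl
  fromℤ-neg -[1+ n ]  = sym (-‿involutive _)

  fromℤ-+ : ∀ i j → fromℤ (i ℤ.+ j) ≈ fromℤ i + fromℤ j
  fromℤ-+ (+ m)    (+ n)    = ×-homo-+ 1# m n
  fromℤ-+ (+ m)    -[1+ n ] = fromℤ-⊖ m (suc n)
  fromℤ-+ -[1+ m ] (+ n)    = trans (fromℤ-⊖ n (suc m)) (+-comm _ _)
  fromℤ-+ -[1+ m ] -[1+ n ] = begin
    - (suc (suc (m ℕ.+ n)) ×′ 1#)        ≡⟨ ≡.cong (λ k → - (k ×′ 1#)) (≡.cong suc (ℕ.+-suc m n)) ⟨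
    - ((suc m ℕ.+ suc n) ×′ 1#)          ≈⟨ -‿cong (×-homo-+ 1# (suc m) (suc n)) ⟩
    - (suc m ×′ 1# + suc n ×′ 1#)        ≈⟨ -‿+-comm _ _ ⟨
    - (suc m ×′ 1#) - (suc n ×′ 1#)      ∎

  fromℤ-+◃ : ∀ n → fromℤ (Sign.+ ℤ.◃ n) ≈ n ×′ 1#
  fromℤ-+◃ n = reflexive (≡.cong fromℤ (ℤ.+◃n≡+n n))

  fromℤ--◃ : ∀ n → fromℤ (Sign.- ℤ.◃ n) ≈ - (n ×′ 1#)
  fromℤ--◃ n = trans (reflexive (≡.cong fromℤ (ℤ.-◃n≡-n n))) (fromℤ-neg (+ n))

  fromℤ-* : ∀ i j → fromℤ (i ℤ.* j) ≈ fromℤ i * fromℤ j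
  fromℤ-* (+ m)    (+ n)    = trans (fromℤ-+◃ (m ℕ.* n)) (×1-homo-* m n)
  fromℤ-* (+ m)    -[1+ n ] = begin
    fromℤ (Sign.- ℤ.◃ (m ℕ.* suc n))     ≈⟨ fromℤ--◃ (m ℕ.* suc n) ⟩
    - ((m ℕ.* suc n) ×′ 1#)              ≈⟨ -‿cong (×1-homo-* m (suc n)) ⟩
    - (m ×′ 1# * suc n ×′ 1#)            ≈⟨ -‿distribʳ-* _ _ ⟩
    m ×′ 1# * - (suc n ×′ 1#)            ∎
  fromℤ-* -[1+ m ] (+ n)    = begin
    fromℤ (Sign.- ℤ.◃ (suc m ℕ.* n))     ≈⟨ fromℤ--◃ (suc m ℕ.* n) ⟩
    - ((suc m ℕ.* n) ×′ 1#)              ≈⟨ -‿cong (×1-homo-* (suc m) n) ⟩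
    - (suc m ×′ 1# * n ×′ 1#)            ≈⟨ -‿distribˡ-* _ _ ⟩
    - (suc m ×′ 1#) * n ×′ 1#            ∎
  fromℤ-* -[1+ m ] -[1+ n ] = begin
    (suc m ℕ.* suc n) ×′ 1#              ≈⟨ ×1-homo-* (suc m) (suc n) ⟩
    suc m ×′ 1# * suc n ×′ 1#            ≈⟨ -‿involutive _ ⟨
    - - (suc m ×′ 1# * suc n ×′ 1#)      ≈⟨ -‿cong (-‿distribˡ-* _ _) ⟩
    - (- (suc m ×′ 1#) * suc n ×′ 1#)    ≈⟨ -‿distribʳ-* _ _ ⟩
    - (suc m ×′ 1#) * - (suc n ×′ 1#)    ∎

  fromℤ-morphism : ℤ.+-*-rawRing -Raw-AlmostCommutative⟶ fromCommutativeRing commutativeRing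
  fromℤ-morphism = record
    { ⟦_⟧    = fromℤ
    ; +-homo = fromℤ-+
    ; *-homo = fromℤ-*
    ; -‿homo = fromℤ-neg
    ; 0-homo = refl
    ; 1-homo = refl
    }

  open RingSolver ℤ.+-*-rawRing (fromCommutativeRing commutativeRing) fromℤ-morphism
    (λ i j → Maybe.map (λ i≡j → reflexive (≡.cong fromℤ i≡j)) (dec⇒maybe (i ℤ.≟ j))) public
    using (Polynomial; solve; con; _:=_; _:+_; _:*_; _:-_; :-_; _:^_)

  :0 :1 : ∀ {k} → Polynomial k
  :0 = con (+ 0)
  :1 = con (+ 1)

  -- Unfolds in the same way as `fromℕ`, so that solved equations match goals containing numerals.
  :fromℕ : ∀ {k} → ℕ → Polynomial k
  :fromℕ zero    = :0
  :fromℕ (suc n) = :1 :+ :fromℕ n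

-- Ordered fields and finite sums

module OrderedField {c ℓ₁ ℓ₂} (R : RealField c ℓ₁ ℓ₂) where
  open RealField R
  open IntegerCoefficients R public
  open IsDecTotalOrder isDecTotalOrder public
    using (antisym)
    renaming (total to ≤-total; refl to ≤-refl; reflexive to ≤-reflexive; trans to ≤-trans;
              ≤-respˡ-≈ to ≤-respˡ; ≤-respʳ-≈ to ≤-respʳ)
  open SemiringMult semiring using (×-homo-+; ×1-homo-*)
  open SemiringSum semiring public
    using (sum-cong-≋; ∑-distrib-+; ∑-comm; sum-permute; *-distribˡ-sum; *-distribʳ-sum; sum-replicate; sum-replicate-zero)

  0≤y-x : ∀ {x y} → x ≤ y → 0# ≤ y - x
  0≤y-x {x} x≤y = ≤-respˡ (-‿inverseʳ x) (+-monoˡ-≤ (- x) x≤y)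

  -- Inequalities are proved by certificates: the solver rewrites the difference as an expression
  -- whose sign can be read off.
  ≤-by : ∀ {x y t} → y - x ≈ t → 0# ≤ t → x ≤ y
  ≤-by {x} {y} eq 0≤t =
    ≤-respʳ (solve 2 (λ x y → (y :- x) :+ x := y) refl x y)
      (≤-respˡ (+-identityˡ x) (+-monoˡ-≤ x (≤-respʳ (sym eq) 0≤t)))

  ≈-by : ∀ {x y u a b} → x - y ≈ u * (a - b) → a ≈ b → x ≈ y
  ≈-by {x} {y} {u} {a} {b} eq a≈b =
    trans (solve 2 (λ x y → x := (x :- y) :+ y) refl x y)
      (trans (+-congʳ (trans eq (trans (*-congˡ (trans (+-congʳ a≈b) (-‿inverseʳ b))) (zeroʳ u))))
        (+-identityˡ y))

  -- A certificate modulo one equation `a ≈ b`, used with multiplier `u`; typically the equation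
  -- defines an inverse, which the solver treats as an unknown.
  ≤-by₁ : ∀ {x y t u a b} → y - x ≈ t + u * (a - b) → a ≈ b → 0# ≤ t → x ≤ y
  ≤-by₁ {x} {y} {t} {u} {a} {b} eq a≈b = ≤-by (trans eq (≈-by
    (solve 4 (λ t u a b → (t :+ u :* (a :- b)) :- t := u :* (a :- b)) refl t u a b) a≈b))

  ≈-by₀ : ∀ {x y} → x - y ≈ 0# → x ≈ y
  ≈-by₀ {x} {y} eq = trans (solve 2 (λ x y → x := (x :- y) :+ y) refl x y)
    (trans (+-congʳ eq) (+-identityˡ y))

  +-nonNegative : ∀ {x y} → 0# ≤ x → 0# ≤ y → 0# ≤ x + y
  +-nonNegative {x} {y} 0≤x 0≤y =
    ≤-trans 0≤y (≤-respˡ (+-identityˡ y) (+-monoˡ-≤ y 0≤x))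

  +-mono-≤ : ∀ {x y u v} → x ≤ y → u ≤ v → x + u ≤ y + v
  +-mono-≤ {x} {y} {u} {v} x≤y u≤v =
    ≤-by (solve 4 (λ x y u v → (y :+ v) :- (x :+ u) := (y :- x) :+ (v :- u)) refl x y u v)
      (+-nonNegative (0≤y-x x≤y) (0≤y-x u≤v))

  *-monoʳ-≤ : ∀ {x u v} → 0# ≤ x → u ≤ v → x * u ≤ x * v
  *-monoʳ-≤ {x} {u} {v} 0≤x u≤v =
    ≤-by (solve 3 (λ x u v → x :* v :- x :* u := x :* (v :- u)) refl x u v)
      (*-nonNegative 0≤x (0≤y-x u≤v))

  *-mono-≤ : ∀ {x y u v} → 0# ≤ u → 0# ≤ y → x ≤ y → u ≤ v → x * u ≤ y * v
  *-mono-≤ {x} {y} {u} {v} 0≤u 0≤y x≤y u≤v =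
    ≤-by (solve 4 (λ x y u v → y :* v :- x :* u := u :* (y :- x) :+ y :* (v :- u)) refl x y u v)
      (+-nonNegative (*-nonNegative 0≤u (0≤y-x x≤y)) (*-nonNegative 0≤y (0≤y-x u≤v)))

  square-nonNegative : ∀ x → 0# ≤ x * x
  square-nonNegative x with ≤-total 0# x
  ... | inj₁ 0≤x = *-nonNegative 0≤x 0≤x
  ... | inj₂ x≤0 = ≤-respʳ (solve 1 (λ x → (:0 :- x) :* (:0 :- x) := x :* x) refl x)
                     (*-nonNegative (0≤y-x x≤0) (0≤y-x x≤0))

  0≤1 : 0# ≤ 1#
  0≤1 = ≤-respʳ (*-identityˡ 1#) (square-nonNegative 1#)

  0<1 : 0# < 1#
  0<1 = 0≤1 , 0≉1

  fromℕ-nonNegative : ∀ n → 0# ≤ fromℕ n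
  fromℕ-nonNegative zero    = ≤-refl
  fromℕ-nonNegative (suc n) = +-nonNegative 0≤1 (fromℕ-nonNegative n)

  <⇒≱ : ∀ {x y} → x < y → ¬ y ≤ x
  <⇒≱ (x≤y , x≉y) y≤x = x≉y (antisym x≤y y≤x)

  ≰⇒> : ∀ {x y} → ¬ x ≤ y → y < x
  ≰⇒> {x} {y} x≰y with ≤-total x y
  ... | inj₁ x≤y = ⊥-elim (x≰y x≤y)
  ... | inj₂ y≤x = y≤x , λ y≈x → x≰y (≤-reflexive (sym y≈x))

  <-≤-trans : ∀ {x y z} → x < y → y ≤ z → x < z
  <-≤-trans (x≤y , x≉y) y≤z = ≤-trans x≤y y≤z , λ x≈z → x≉y (antisym x≤y (≤-respʳ (sym x≈z) y≤z))

  pos⇒≉0 : ∀ {x} → 0# < x → ¬ x ≈ 0#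
  pos⇒≉0 (_ , 0≉x) x≈0 = 0≉x (sym x≈0)

  *-cancelˡ-0 : ∀ {x y} → 0# < x → x * y ≈ 0# → y ≈ 0#
  *-cancelˡ-0 {x} {y} 0<x xy≈0 =
    trans (≈-by {u = - y} (solve 3 (λ x y i → y :- i :* (x :* y) := (:- y) :* (x :* i :- :1)) refl x y (x ⁻¹))
             (*-inverseʳ x (pos⇒≉0 0<x)))
      (trans (*-congˡ xy≈0) (zeroʳ (x ⁻¹)))

  *-cancelˡ-0≤ : ∀ {x y} → 0# < x → 0# ≤ x * y → 0# ≤ y
  *-cancelˡ-0≤ {x} {y} 0<x 0≤xy with ≤-total 0# y
  ... | inj₁ 0≤y = 0≤y
  ... | inj₂ y≤0 = ≤-reflexive (sym (*-cancelˡ-0 0<x (antisym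
          (≤-by (solve 2 (λ x y → :0 :- x :* y := x :* (:0 :- y)) refl x y)
             (*-nonNegative (proj₁ 0<x) (0≤y-x y≤0)))
          0≤xy)))

  *-cancelˡ-≤ : ∀ {x y z} → 0# < x → x * y ≤ x * z → y ≤ z
  *-cancelˡ-≤ {x} {y} {z} 0<x xy≤xz = ≤-by refl (*-cancelˡ-0≤ 0<x
    (≤-respʳ (solve 3 (λ x y z → x :* z :- x :* y := x :* (z :- y)) refl x y z) (0≤y-x xy≤xz)))

  *-cancelˡ : ∀ {x y z} → 0# < x → x * y ≈ x * z → y ≈ z
  *-cancelˡ 0<x xy≈xz = antisym (*-cancelˡ-≤ 0<x (≤-reflexive xy≈xz))
                                (*-cancelˡ-≤ 0<x (≤-reflexive (sym xy≈xz)))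

  *-positive : ∀ {x y} → 0# < x → 0# < y → 0# < x * y
  *-positive 0<x 0<y = *-nonNegative (proj₁ 0<x) (proj₁ 0<y) ,
                       λ 0≈xy → pos⇒≉0 0<y (*-cancelˡ-0 0<x (sym 0≈xy))

  ⁻¹-inverse : ∀ {x} → 0# < x → x * x ⁻¹ ≈ 1#
  ⁻¹-inverse 0<x = *-inverseʳ _ (pos⇒≉0 0<x)

  ⁻¹-positive : ∀ {x} → 0# < x → 0# < x ⁻¹
  ⁻¹-positive {x} 0<x =
    *-cancelˡ-0≤ 0<x (≤-respʳ (sym (⁻¹-inverse 0<x)) 0≤1) ,
    λ 0≈i → 0≉1 (trans (sym (zeroʳ x)) (trans (*-congˡ 0≈i) (⁻¹-inverse 0<x)))

  square-cancel-≤ : ∀ {x y} → 0# ≤ y → x * x ≤ y * y → x ≤ y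
  square-cancel-≤ {x} {y} 0≤y x²≤y² with x ≤? y
  ... | yes x≤y = x≤y
  ... | no  x≰y = ⊥-elim (<⇒≱ y<x (*-cancelˡ-≤ 0<x (≤-trans x²≤y²
                    (≤-by (solve 2 (λ x y → x :* y :- y :* y := y :* (x :- y)) refl x y)
                      (*-nonNegative 0≤y (0≤y-x (proj₁ y<x)))))))
    where
    y<x = ≰⇒> x≰y
    0<x : 0# < x
    0<x = ≤-trans 0≤y (proj₁ y<x) , λ 0≈x → x≰y (≤-respˡ 0≈x 0≤y)

  cube-cancel-≤ : ∀ {x y} → 0# < x → x ^ 3 ≤ y ^ 3 → x ≤ y
  cube-cancel-≤ {x} {y} 0<x x³≤y³ with x ≤? y
  ... | yes x≤y = x≤y
  ... | no  x≰y = ⊥-elim (<⇒≱ 0<s (*-cancelˡ-≤ 0<x-y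
      (≤-by (solve 2 (λ x y → (x :- y) :* :0 :- (x :- y) :* ((:fromℕ 2 :* y :+ x) :* (:fromℕ 2 :* y :+ x) :+ :fromℕ 3 :* (x :* x))
                 := :fromℕ 4 :* (y :^ 3 :- x :^ 3)) refl x y)
        (*-nonNegative (fromℕ-nonNegative 4) (0≤y-x x³≤y³)))))
    where
    y<x = ≰⇒> x≰y
    0<x-y : 0# < x - y
    0<x-y = 0≤y-x (proj₁ y<x) , λ 0≈x-y → proj₂ y<x (sym (≈-by₀ (sym 0≈x-y)))
    -- The cofactor of `x - y` in `x ^ 3 - y ^ 3`, times 4 to complete the square.
    s = (fromℕ 2 * y + x) * (fromℕ 2 * y + x) + fromℕ 3 * (x * x)
    0<s : 0# < s
    0<s = <-≤-trans (*-positive 0<x 0<x)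
      (≤-by (solve 2 (λ x y → ((:fromℕ 2 :* y :+ x) :* (:fromℕ 2 :* y :+ x) :+ :fromℕ 3 :* (x :* x)) :- x :* x
                 := (:fromℕ 2 :* y :+ x) :* (:fromℕ 2 :* y :+ x) :+ :fromℕ 2 :* (x :* x)) refl x y)
        (+-nonNegative (square-nonNegative _) (*-nonNegative (fromℕ-nonNegative 2) (square-nonNegative x))))

  fromℕ-positive : ∀ n → 0# < fromℕ (suc n)
  fromℕ-positive n = <-≤-trans 0<1 (≤-respˡ (+-identityʳ 1#) (+-mono-≤ ≤-refl (fromℕ-nonNegative n)))

  fromℕ-+ : ∀ m n → fromℕ (m ℕ.+ n) ≈ fromℕ m + fromℕ n
  fromℕ-+ = ×-homo-+ 1#

  fromℕ-* : ∀ m n → fromℕ (m ℕ.* n) ≈ fromℕ m * fromℕ n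
  fromℕ-* = ×1-homo-*

  fromℕ-^ : ∀ m k → fromℕ (m ℕ.^ k) ≈ fromℕ m ^ k
  fromℕ-^ m zero    = +-identityʳ 1#
  fromℕ-^ m (suc k) = trans (fromℕ-* m (m ℕ.^ k)) (*-congˡ (fromℕ-^ m k))

  fromℕ-mono : ∀ {m n} → m ℕ.≤ n → fromℕ m ≤ fromℕ n
  fromℕ-mono {n = n} ℕ.z≤n   = fromℕ-nonNegative n
  fromℕ-mono (ℕ.s≤s m≤n)     = +-mono-≤ ≤-refl (fromℕ-mono m≤n)

  sum-mono : ∀ {n} {f g : Fin n → Carrier} → (∀ i → f i ≤ g i) → sum f ≤ sum g
  sum-mono {zero}  f≤g = ≤-refl
  sum-mono {suc n} f≤g = +-mono-≤ (f≤g Fin.zero) (sum-mono (λ i → f≤g (Fin.suc i)))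

  sum-nonNegative : ∀ {n} {f : Fin n → Carrier} → (∀ i → 0# ≤ f i) → 0# ≤ sum f
  sum-nonNegative {n} 0≤f = ≤-respˡ (sum-replicate-zero n) (sum-mono 0≤f)

  -- The hypothesis says that f takes one common value on the supports of g and e.
  sum-exchange : ∀ {n} (g e f : Fin n → Carrier) →
                 (∀ i j → g i * e j * f i ≈ g i * e j * f j) →
                 sum e * sum (λ i → g i * f i) ≈ sum g * sum (λ j → e j * f j)
  sum-exchange g e f agree =
    trans (*-distribʳ-sum _ e)
      (trans (sum-cong-≋ (λ j → *-distribˡ-sum (e j) (λ i → g i * f i)))
        (trans (∑-comm (λ j i → e j * (g i * f i)))
          (trans (sum-cong-≋ (λ i → sum-cong-≋ (λ j →
               trans (solve 3 (λ e g f → e :* (g :* f) := g :* e :* f) refl (e j) (g i) (f i))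
                 (trans (agree i j) (*-assoc (g i) (e j) (f j))))))
            (trans (sum-cong-≋ (λ i → sym (*-distribˡ-sum (g i) (λ j → e j * f j))))
              (sym (*-distribʳ-sum _ g))))))

-- Transpositions

transpose-matchˡ : ∀ {n} (i j : Fin n) → Components.transpose i j i ≡ j
transpose-matchˡ i j rewrite dec-true (i Fin.≟ i) ≡.refl = ≡.refl

transpose-mismatch : ∀ {n} {i j k : Fin n} → k ≢ i → k ≢ j → Components.transpose i j k ≡ k
transpose-mismatch {i = i} {j} {k} k≢i k≢j
  rewrite dec-false (k Fin.≟ i) k≢i | dec-false (k Fin.≟ j) k≢j = ≡.refl

transpose-invariant : ∀ {a n} {A : Set a} (f : Fin n → A) {i j} → f i ≡ f j →
                      ∀ k → f (Components.transpose i j k) ≡ f k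
transpose-invariant f {i} {j} fi≡fj k with k Fin.≟ i
... | yes ≡.refl = ≡.sym fi≡fj
... | no _ with k Fin.≟ j
...   | yes ≡.refl = fi≡fj
...   | no _       = ≡.refl

map-transpose : ∀ {n k} {i j : Fin n} (v : Vec (Fin n) k) → i ∉ v → j ∉ v →
                map (Components.transpose i j) v ≡ v
map-transpose []      i∉v j∉v = ≡.refl
map-transpose (x ∷ v) i∉v j∉v = ≡.cong₂ _∷_
  (transpose-mismatch (i∉v ∘ here ∘ ≡.sym) (j∉v ∘ here ∘ ≡.sym))
  (map-transpose v (i∉v ∘ there) (j∉v ∘ there))

does-≟-injective : ∀ {m n} {f : Fin m → Fin n} → (∀ {x y} → f x ≡ f y → x ≡ y) →
                   ∀ x y → does (f x Fin.≟ f y) ≡ does (x Fin.≟ y)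
does-≟-injective {f = f} inj x y with x Fin.≟ y
... | yes ≡.refl = dec-true (f x Fin.≟ f x) ≡.refl
... | no x≢y     = dec-false (f x Fin.≟ f y) (x≢y ∘ inj)

-- Symmetry of the success probability

module Sampling {c ℓ₁ ℓ₂} (R : RealField c ℓ₁ ℓ₂) where
  open RealField R
  open Hybrid R
  open OrderedField R

  module _ {n} (I : Instance n) (ε : Carrier) where
    open Instance I


    -- An algorithm learns only weights and the results of equality tests, and `π` preserves both;
    -- each sum over the next item is reindexed along `π`.
    permute-successProbability :
      ∀ {m k} (π : Permutation′ n) → (∀ x → weight (π ⟨$⟩ʳ x) ≡ weight x) →
      (A : Algorithm m k) (v : Vec (Fin n) k) →
      successProbability I ε A (map (π ⟨$⟩ʳ_) v) ≈ successProbability I ε A v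
    permute-successProbability π inv (output Ŵ) v = refl
    permute-successProbability π inv (proportional next) v = trans
      (sum-permute (λ a → weight a / W * successProbability I ε (next (weight a)) (a ∷ map (π ⟨$⟩ʳ_) v)) π)
      (sum-cong-≋ λ a → *-cong (*-congʳ (reflexive (inv a))) (trans
        (reflexive (≡.cong (λ w → successProbability I ε (next w) ((π ⟨$⟩ʳ a) ∷ map (π ⟨$⟩ʳ_) v)) (inv a)))
        (permute-successProbability π inv (next (weight a)) (a ∷ v))))
    permute-successProbability π inv (uniform next) v = trans
      (sum-permute (λ a → 1# / fromℕ n * successProbability I ε (next (weight a)) (a ∷ map (π ⟨$⟩ʳ_) v)) π)
      (sum-cong-≋ λ a → *-congˡ (trans
        (reflexive (≡.cong (λ w → successProbability I ε (next w) ((π ⟨$⟩ʳ a) ∷ map (π ⟨$⟩ʳ_) v)) (inv a)))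
        (permute-successProbability π inv (next (weight a)) (a ∷ v))))
    permute-successProbability π inv (compare i j next) v
      rewrite lookup-map i (π ⟨$⟩ʳ_) v | lookup-map j (π ⟨$⟩ʳ_) v
            | does-≟-injective {f = π ⟨$⟩ʳ_} (λ {x} {y} eq →
                ≡.trans (≡.sym (inverseˡ π)) (≡.trans (≡.cong (π ⟨$⟩ˡ_) eq) (inverseˡ π)))
                (lookup v i) (lookup v j)
      = permute-successProbability π inv (next _) v

    -- The transposition of `x` and `y` preserves the weights and fixes every item already held.
    -- This is the form in which opacity of the items is used.
    fresh-successProbability :
      ∀ {m k} (next : Carrier → Algorithm m (suc k)) {v : Vec (Fin n) k} {x y} →
      weight x ≡ weight y → x ∉ v → y ∉ v →
      successProbability I ε (next (weight x)) (x ∷ v) ≈ successProbability I ε (next (weight y)) (y ∷ v)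
    fresh-successProbability next {v} {x} {y} wx≡wy x∉v y∉v = trans
      (sym (permute-successProbability (transpose x y) (transpose-invariant weight wx≡wy)
        (next (weight x)) (x ∷ v)))
      (reflexive (≡.cong₂ (λ w u → successProbability I ε (next w) u) wx≡wy
        (≡.cong₂ _∷_ (transpose-matchˡ x y) (map-transpose v x∉v y∉v))))

-- Inequalities between likelihoods and for the χ²-divergence

module Scalars {c ℓ₁ ℓ₂} (R : RealField c ℓ₁ ℓ₂) where
  open RealField R
  open OrderedField R

  -- A weighting μ and its variant q in which the weight w of every point marked by e is
  -- moved to the points marked by g.
  sum-redistribute : ∀ {n} (g e μ q f : Fin n → Carrier) {t w} →
    (∀ i j → g i * e j * f i ≈ g i * e j * f j) →
    0# < sum g → t * sum g ≈ sum e →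
    (∀ i → μ i + t * w * g i ≈ q i + w * e i) →
    sum (λ i → μ i * f i) ≈ sum (λ i → q i * f i)
  sum-redistribute {n} g e μ q f {t} {w} agree 0<Σg tΣg≈Σe moved = cancel total tG≈E
    where
    G = sum (λ i → g i * f i)
    E = sum (λ i → e i * f i)
    tG≈E : t * G ≈ E
    tG≈E = *-cancelˡ 0<Σg (trans
      (solve 3 (λ t s G → s :* (t :* G) := t :* s :* G) refl t (sum g) G)
      (trans (*-congʳ tΣg≈Σe) (sum-exchange g e f agree)))
    expand : ∀ (μ g : Fin n → Carrier) w →
      sum (λ i → (μ i + w * g i) * f i) ≈ sum (λ i → μ i * f i) + w * sum (λ i → g i * f i)
    expand μ g w = trans
      (sum-cong-≋ λ i → solve 4 (λ m w g f → (m :+ w :* g) :* f := m :* f :+ w :* (g :* f)) refl (μ i) w (g i) (f i))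
      (trans (∑-distrib-+ (λ i → μ i * f i) (λ i → w * (g i * f i)))
        (+-congˡ (sym (*-distribˡ-sum w (λ i → g i * f i)))))
    total : sum (λ i → μ i * f i) + t * w * G ≈ sum (λ i → q i * f i) + w * E
    total = trans (sym (expand μ g (t * w)))
      (trans (sum-cong-≋ λ i → *-congʳ (moved i)) (expand q e w))
    cancel : ∀ {x y} → x + t * w * G ≈ y + w * E → t * G ≈ E → x ≈ y
    cancel {x} {y} eq₁ eq₂ = trans
      (solve 4 (λ x t w G → x := (x :+ t :* w :* G) :- w :* (t :* G)) refl x t w G)
      (trans (+-cong eq₁ (-‿cong (*-congˡ eq₂)))
        (solve 3 (λ y w E → (y :+ w :* E) :- w :* E := y) refl y w E))

  -- With b = L a and c ≥ b² / a, this is 8 (p₁ + L p₂) ≤ 9 − 4 L + 4 C L². For C = 1 the right-hand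
  -- side touches 8 and 8 L from above at L = 1/2 and L = 3/2, so it bounds 8 max(1, L); as it is
  -- quadratic, only the second moment of L grows when further samples are drawn.
  Bound : (a b c C p₁ p₂ : Carrier) → Set ℓ₂
  Bound a b c C p₁ p₂ =
    fromℕ 8 * (a * p₁ + b * p₂) + fromℕ 4 * b ≤ fromℕ 9 * a + fromℕ 4 * (c * C)

  -- `Bound` is linear in `a`, `b`, `c`, so the bounds for the single outcomes can be added. In the
  -- application `κ` dominates `p² / q`, so `K - 1` bounds the χ²-divergence of one sample; it is
  -- absorbed into `C`.
  Bound-sum : ∀ {n} (q p κ f₁ f₂ : Fin n → Carrier) {a b c C K} →
    sum q ≈ 1# → sum p ≈ 1# → sum κ ≤ K → 0# ≤ c * C →
    (∀ i → Bound (a * q i) (b * p i) (c * κ i) C (f₁ i) (f₂ i)) →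
    Bound a b c (K * C) (sum (λ i → q i * f₁ i)) (sum (λ i → p i * f₂ i))
  Bound-sum q p κ f₁ f₂ {a} {b} {c} {C} {K} Σq≈1 Σp≈1 Σκ≤K 0≤cC bound =
    ≤-by₁ {u = fromℕ 4 * b}
      (solve 10 (λ a b c C K p q k F₁ F₂ →
        let lhs = :fromℕ 8 :* (a :* F₁ :+ b :* F₂) in
        (:fromℕ 9 :* a :+ :fromℕ 4 :* (c :* (K :* C))) :- (lhs :+ :fromℕ 4 :* b) :=
        ((:fromℕ 9 :* a :* (:1) :+ :fromℕ 4 :* (c :* C) :* k) :- (lhs :+ :fromℕ 4 :* b :* p)
          :+ :fromℕ 4 :* (c :* C :* (K :- k)))
        :+ :fromℕ 4 :* b :* (p :- :1)) refl a b c C K (sum p) (sum q) (sum κ) F₁ F₂)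
      Σp≈1
      (+-nonNegative (0≤y-x (≤-respʳ (+-congʳ (*-congˡ Σq≈1)) total))
        (*-nonNegative (fromℕ-nonNegative 4) (*-nonNegative 0≤cC (0≤y-x Σκ≤K))))
    where
    F₁ = sum (λ i → q i * f₁ i)
    F₂ = sum (λ i → p i * f₂ i)
    linear₂ : ∀ {n} x y (f g : Fin n → Carrier) →
      sum (λ i → x * f i + y * g i) ≈ x * sum f + y * sum g
    linear₂ x y f g = trans (∑-distrib-+ (λ i → x * f i) (λ i → y * g i))
      (+-cong (sym (*-distribˡ-sum x f)) (sym (*-distribˡ-sum y g)))
    total : fromℕ 8 * (a * F₁ + b * F₂) + fromℕ 4 * b * sum p ≤
            fromℕ 9 * a * sum q + fromℕ 4 * (c * C) * sum κ
    total = ≤-respʳ (linear₂ (fromℕ 9 * a) (fromℕ 4 * (c * C)) q κ)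
      (≤-respˡ
        (trans (∑-distrib-+ _ (λ i → fromℕ 4 * b * p i)) (+-cong
          (trans (sym (*-distribˡ-sum (fromℕ 8) (λ i → a * (q i * f₁ i) + b * (p i * f₂ i))))
            (*-congˡ (linear₂ a b (λ i → q i * f₁ i) (λ i → p i * f₂ i))))
          (sym (*-distribˡ-sum (fromℕ 4 * b) p))))
        (sum-mono λ i → ≤-by
          (solve 9 (λ a b c C p q k f₁ f₂ →
            (:fromℕ 9 :* a :* q :+ :fromℕ 4 :* (c :* C) :* k)
              :- (:fromℕ 8 :* (a :* (q :* f₁) :+ b :* (p :* f₂)) :+ :fromℕ 4 :* b :* p)
            := (:fromℕ 9 :* (a :* q) :+ :fromℕ 4 :* (c :* k :* C))
              :- (:fromℕ 8 :* (a :* q :* f₁ :+ b :* p :* f₂) :+ :fromℕ 4 :* (b :* p)))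
            refl a b c C (p i) (q i) (κ i) (f₁ i) (f₂ i))
          (0≤y-x (bound i))))

  Bound-cong : ∀ {a b c C p₁ p₂ q₁ q₂} → p₁ ≈ q₁ → p₂ ≈ q₂ → Bound a b c C q₁ q₂ → Bound a b c C p₁ p₂
  Bound-cong p₁≈q₁ p₂≈q₂ =
    ≤-respˡ (+-congʳ (*-congˡ (+-cong (*-congˡ (sym p₁≈q₁)) (*-congˡ (sym p₂≈q₂)))))

  Bound-mono : ∀ {a b c C C′ p₁ p₂} → 0# ≤ c → C ≤ C′ → Bound a b c C p₁ p₂ → Bound a b c C′ p₁ p₂
  Bound-mono 0≤c C≤C′ bound = ≤-trans bound
    (+-mono-≤ ≤-refl (*-monoʳ-≤ (fromℕ-nonNegative 4) (*-monoʳ-≤ 0≤c C≤C′)))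

  module _ {a b c : Carrier} (0≤a : 0# ≤ a) (0≤c : 0# ≤ c) (b²≤ac : b * b ≤ a * c) where

    -- The inequality of arithmetic and geometric means for `a` and `4 c`, proved on squares. It is
    -- the tangency at `L = 1/2`; the next lemma is the one at `L = 3/2`.
    4b≤a+4c : fromℕ 4 * b ≤ a + fromℕ 4 * c
    4b≤a+4c = square-cancel-≤ (+-nonNegative 0≤a (*-nonNegative (fromℕ-nonNegative 4) 0≤c))
      (≤-by (solve 3 (λ a b c →
          (a :+ :fromℕ 4 :* c) :* (a :+ :fromℕ 4 :* c) :- :fromℕ 4 :* b :* (:fromℕ 4 :* b) :=
          (a :- :fromℕ 4 :* c) :* (a :- :fromℕ 4 :* c) :+ :fromℕ 16 :* (a :* c :- b :* b)) refl a b c)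
        (+-nonNegative (square-nonNegative _)
          (*-nonNegative (fromℕ-nonNegative 16) (0≤y-x b²≤ac))))

    12b≤9a+4c : fromℕ 12 * b ≤ fromℕ 9 * a + fromℕ 4 * c
    12b≤9a+4c = square-cancel-≤
      (+-nonNegative (*-nonNegative (fromℕ-nonNegative 9) 0≤a) (*-nonNegative (fromℕ-nonNegative 4) 0≤c))
      (≤-by (solve 3 (λ a b c →
          (:fromℕ 9 :* a :+ :fromℕ 4 :* c) :* (:fromℕ 9 :* a :+ :fromℕ 4 :* c)
            :- :fromℕ 12 :* b :* (:fromℕ 12 :* b) :=
          (:fromℕ 9 :* a :- :fromℕ 4 :* c) :* (:fromℕ 9 :* a :- :fromℕ 4 :* c)
            :+ :fromℕ 144 :* (a :* c :- b :* b)) refl a b c)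
        (+-nonNegative (square-nonNegative _)
          (*-nonNegative (fromℕ-nonNegative 144) (0≤y-x b²≤ac))))

    module _ {C : Carrier} (1≤C : 1# ≤ C) where

      private
        4c[C-1]≥0 : 0# ≤ fromℕ 4 * (c * (C - 1#))
        4c[C-1]≥0 = *-nonNegative (fromℕ-nonNegative 4) (*-nonNegative 0≤c (0≤y-x 1≤C))

      Bound-left : Bound a b c C 1# 0#
      Bound-left = ≤-by (solve 4 (λ a b c C →
          (:fromℕ 9 :* a :+ :fromℕ 4 :* (c :* C)) :- (:fromℕ 8 :* (a :* :1 :+ b :* :0) :+ :fromℕ 4 :* b) :=
          ((a :+ :fromℕ 4 :* c) :- :fromℕ 4 :* b) :+ :fromℕ 4 :* (c :* (C :- :1))) refl a b c C)
        (+-nonNegative (0≤y-x 4b≤a+4c) 4c[C-1]≥0)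

      Bound-right : Bound a b c C 0# 1#
      Bound-right = ≤-by (solve 4 (λ a b c C →
          (:fromℕ 9 :* a :+ :fromℕ 4 :* (c :* C)) :- (:fromℕ 8 :* (a :* :0 :+ b :* :1) :+ :fromℕ 4 :* b) :=
          ((:fromℕ 9 :* a :+ :fromℕ 4 :* c) :- :fromℕ 12 :* b) :+ :fromℕ 4 :* (c :* (C :- :1))) refl a b c C)
        (+-nonNegative (0≤y-x 12b≤9a+4c) 4c[C-1]≥0)

      Bound-neither : Bound a b c C 0# 0#
      Bound-neither = ≤-by (solve 4 (λ a b c C →
          (:fromℕ 9 :* a :+ :fromℕ 4 :* (c :* C)) :- (:fromℕ 8 :* (a :* :0 :+ b :* :0) :+ :fromℕ 4 :* b) :=
          (((a :+ :fromℕ 4 :* c) :- :fromℕ 4 :* b) :+ :fromℕ 8 :* a) :+ :fromℕ 4 :* (c :* (C :- :1))) refl a b c C)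
        (+-nonNegative (+-nonNegative (0≤y-x 4b≤a+4c) (*-nonNegative (fromℕ-nonNegative 8) 0≤a)) 4c[C-1]≥0)

      Bound-indicators : ∀ {p q} {P : Set p} {Q : Set q} (P? : Dec P) (Q? : Dec Q) → (P → ¬ Q) →
        Bound a b c C (if does P? then 1# else 0#) (if does Q? then 1# else 0#)
      Bound-indicators (yes p) (yes q) disjoint = ⊥-elim (disjoint p q)
      Bound-indicators (yes _) (no _)  _        = Bound-left
      Bound-indicators (no _)  (yes _) _        = Bound-right
      Bound-indicators (no _)  (no _)  _        = Bound-neither

  -- For outcomes without mass. It serves the extra items, to which the induction hypothesis does
  -- not apply.
  Bound-zero : ∀ a b c C p₁ p₂ → Bound (a * 0#) (b * 0#) (c * 0#) C p₁ p₂
  Bound-zero a b c C p₁ p₂ = ≤-by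
    (solve 6 (λ a b c C p₁ p₂ →
      (:fromℕ 9 :* (a :* :0) :+ :fromℕ 4 :* (c :* :0 :* C))
        :- (:fromℕ 8 :* (a :* :0 :* p₁ :+ b :* :0 :* p₂) :+ :fromℕ 4 :* (b :* :0)) := :0)
      refl a b c C p₁ p₂)
    ≤-refl

  module _ {h d sH N t₂ : Carrier}
    (0<h : 0# < h) (0≤d : 0# ≤ d) (0≤t₂ : 0# ≤ t₂)
    (sH+N≈h : sH + N ≈ h) (t₂N≈d : t₂ * N ≈ d) (h≤2N : h ≤ fromℕ 2 * N)
    where

    private
      ht₂≤2d : h * t₂ ≤ fromℕ 2 * d
      ht₂≤2d = ≤-respʳ (*-congˡ t₂N≈d)
        (≤-by (solve 3 (λ h t N → :fromℕ 2 :* (t :* N) :- h :* t := t :* (:fromℕ 2 :* N :- h)) refl h t₂ N)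
          (*-nonNegative 0≤t₂ (0≤y-x h≤2N)))

    -- 1 − t₁ + t₁² replaces the exact value 1/(1 + t₁), which it exceeds.
    uniform-χ² : ∀ {z sL Z n x t₁ ν} → 0# ≤ t₁ → t₁ * Z ≈ d → 0# ≤ ν → n * ν ≈ 1# →
      n ≈ h + (d + z) → sL + Z ≈ z → h ≤ Z →
      fromℕ 4 * (d * d) ≤ x * (n * h) →
      ν * sH + (ν * ((1# + t₂) * (1# + t₂)) * N + (ν * sL + ν * (1# - t₁ + t₁ * t₁) * Z)) ≤ 1# + x
    uniform-χ² {z} {sL} {Z} {n} {x} {t₁} {ν} 0≤t₁ t₁Z≈d 0≤ν nν≈1 n≈ sL+Z≈z h≤Z d²≤ = ≤-respˡ (sym total)
      (+-mono-≤ ≤-refl (≤-respʳ (trans (solve 3 (λ ν x n → ν :* (x :* n) := n :* ν :* x) refl ν x n)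
        (trans (*-congʳ nν≈1) (*-identityˡ x))) (*-monoʳ-≤ 0≤ν excess)))
      where
      -- To first order the new heavy items gain `2 d` and the new light ones lose `d`; the balance
      -- `d` makes up for the missing extra items, so only second-order terms exceed 1.
      total : _ ≈ 1# + ν * ((t₁ + t₂) * d)
      total = trans
        (solve 7 (λ ν sH N sL Z t₁ t₂ →
          ν :* sH :+ (ν :* ((:1 :+ t₂) :* (:1 :+ t₂)) :* N :+ (ν :* sL :+ ν :* (:1 :- t₁ :+ t₁ :* t₁) :* Z))
          := ν :* (((sH :+ N) :+ (:fromℕ 2 :+ t₂) :* (t₂ :* N)) :+ ((sL :+ Z) :+ (t₁ :- :1) :* (t₁ :* Z))))
          refl ν sH N sL Z t₁ t₂)
        (trans (*-congˡ (+-cong (+-cong sH+N≈h (*-congˡ t₂N≈d)) (+-cong sL+Z≈z (*-congˡ t₁Z≈d))))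
        (trans (solve 6 (λ ν h d z t₁ t₂ →
          ν :* ((h :+ (:fromℕ 2 :+ t₂) :* d) :+ (z :+ (t₁ :- :1) :* d))
          := (h :+ (d :+ z)) :* ν :+ ν :* ((t₁ :+ t₂) :* d)) refl ν h d z t₁ t₂)
        (+-congʳ (trans (*-congʳ (sym n≈)) nν≈1))))
      ht₁≤d : h * t₁ ≤ d
      ht₁≤d = ≤-respʳ t₁Z≈d
        (≤-by (solve 3 (λ h t Z → t :* Z :- h :* t := t :* (Z :- h)) refl h t₁ Z)
          (*-nonNegative 0≤t₁ (0≤y-x h≤Z)))
      -- `t₁` is at most `d / h` and `t₂` at most `2 d / h`, which makes `3 d² / h`; the constant 4
      -- has room to spare.
      excess : (t₁ + t₂) * d ≤ x * n
      excess = *-cancelˡ-≤ 0<h (≤-by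
        (solve 6 (λ h t₁ t₂ d x n → h :* (x :* n) :- h :* ((t₁ :+ t₂) :* d) :=
          (x :* (n :* h) :- :fromℕ 4 :* (d :* d)) :+
          (d :* (d :- h :* t₁) :+ (d :* (:fromℕ 2 :* d :- h :* t₂) :+ d :* d))) refl h t₁ t₂ d x n)
        (+-nonNegative (0≤y-x d²≤) (+-nonNegative (*-nonNegative 0≤d (0≤y-x ht₁≤d))
          (+-nonNegative (*-nonNegative 0≤d (0≤y-x ht₂≤2d)) (*-nonNegative 0≤d 0≤d)))))

    -- The excess over 1 is exactly `ω² sH t₂ d`. It vanishes as long as no heavy item has been
    -- seen: only the chance of a repetition is informative.
    proportional-χ² : ∀ {m x ω} → (h + d) * ω ≈ 1# → 0# ≤ x → 0# ≤ sH → sH ≤ m →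
      fromℕ 2 * (d * d) * m ≤ x * (h * h * h) →
      h * (ω * ω) * sH + h * (ω * (1# + t₂) * (ω * (1# + t₂))) * N ≤ 1# + x
    proportional-χ² {m} {x} {ω} [h+d]ω≈1 0≤x 0≤sH sH≤m d²m≤ = ≤-respˡ (sym total) (≤-respʳ unit
      (≤-by (solve 6 (λ h d x t sH ω →
          (:1 :+ x) :* ((h :+ d) :* ω :* ((h :+ d) :* ω)) :- ω :* ω :* (h :* h :+ :fromℕ 2 :* (h :* d) :+ (sH :* t :* d :+ d :* d)) :=
          ω :* ω :* ((x :* (h :* h) :- sH :* t :* d) :+ x :* (d :* (:fromℕ 2 :* h :+ d)))) refl h d x t₂ sH ω)
        (*-nonNegative (square-nonNegative ω) (+-nonNegative (0≤y-x excess)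
          (*-nonNegative 0≤x (*-nonNegative 0≤d (+-nonNegative (*-nonNegative (fromℕ-nonNegative 2) (proj₁ 0<h)) 0≤d)))))))
      where
      unit : (1# + x) * ((h + d) * ω * ((h + d) * ω)) ≈ 1# + x
      unit = trans (*-congˡ (trans (*-cong [h+d]ω≈1 [h+d]ω≈1) (*-identityˡ 1#))) (*-identityʳ _)
      total : _ ≈ ω * ω * (h * h + fromℕ 2 * (h * d) + (sH * t₂ * d + d * d))
      total = trans
        (solve 5 (λ h ω sH N t → h :* (ω :* ω) :* sH :+ h :* (ω :* (:1 :+ t) :* (ω :* (:1 :+ t))) :* N :=
           ω :* ω :* (h :* ((sH :+ N) :+ (:fromℕ 2) :* (t :* N)) :+ h :* t :* (t :* N))) refl h ω sH N t₂)
        (*-congˡ (+-cong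
          (trans (*-congˡ (+-cong sH+N≈h (*-congˡ t₂N≈d)))
            (solve 2 (λ h d → h :* (h :+ :fromℕ 2 :* d) := h :* h :+ :fromℕ 2 :* (h :* d)) refl h d))
          (trans (*-cong (*-congʳ (sym sH+N≈h)) t₂N≈d)
            (trans (solve 4 (λ sH N t d → (sH :+ N) :* t :* d := sH :* t :* d :+ t :* N :* d) refl sH N t₂ d)
              (+-congˡ (*-congʳ t₂N≈d))))))
      excess : sH * t₂ * d ≤ x * (h * h)
      excess = *-cancelˡ-≤ 0<h (≤-by
        (solve 6 (λ h sH t d x m → h :* (x :* (h :* h)) :- h :* (sH :* t :* d) :=
          (x :* (h :* h :* h) :- :fromℕ 2 :* (d :* d) :* m) :+
          (:fromℕ 2 :* (d :* d) :* (m :- sH) :+ sH :* d :* (:fromℕ 2 :* d :- h :* t))) refl h sH t₂ d x m)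
        (+-nonNegative (0≤y-x d²m≤) (+-nonNegative
          (*-nonNegative (*-nonNegative (fromℕ-nonNegative 2) (*-nonNegative 0≤d 0≤d)) (0≤y-x sH≤m))
          (*-nonNegative (*-nonNegative 0≤sH 0≤d) (0≤y-x ht₂≤2d)))))

-- Items classified by kind and by whether they are held

data Kind : Set where
  heavy extra light : Kind

-- Extra items are not split into seen and new, because the coupled histories contain none.
data Class : Set where
  seenHeavy newHeavy extra seenLight newLight : Class

classify : Kind → Bool → Class
classify heavy true  = seenHeavy
classify heavy false = newHeavy
classify extra _     = extra
classify light true  = seenLight
classify light false = newLight

pickKind : ∀ {a} {A : Set a} → A → A → A → Kind → A
pickKind x y z heavy = x
pickKind x y z extra = y
pickKind x y z light = z

pick : ∀ {a} {A : Set a} → A → A → A → A → A → Class → A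
pick sH nH e sL nL seenHeavy = sH
pick sH nH e sL nL newHeavy  = nH
pick sH nH e sL nL extra     = e
pick sH nH e sL nL seenLight = sL
pick sH nH e sL nL newLight  = nL

module Classes {c ℓ₁ ℓ₂} (R : RealField c ℓ₁ ℓ₂) where
  open RealField R
  open OrderedField R

  isSeenHeavy isNewHeavy isExtra isSeenLight isNewLight : Class → Carrier
  isSeenHeavy = pick 1# 0# 0# 0# 0#
  isNewHeavy  = pick 0# 1# 0# 0# 0#
  isExtra     = pick 0# 0# 1# 0# 0#
  isSeenLight = pick 0# 0# 0# 1# 0#
  isNewLight  = pick 0# 0# 0# 0# 1#

  pick-nonNegative : ∀ {p q r s t} → 0# ≤ p → 0# ≤ q → 0# ≤ r → 0# ≤ s → 0# ≤ t →
                     ∀ x → 0# ≤ pick p q r s t x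
  pick-nonNegative p q r s t seenHeavy = p
  pick-nonNegative p q r s t newHeavy  = q
  pick-nonNegative p q r s t extra     = r
  pick-nonNegative p q r s t seenLight = s
  pick-nonNegative p q r s t newLight  = t

  sum-pick : ∀ {n} p q r s t (cls : Fin n → Class) →
    sum (pick p q r s t ∘ cls) ≈
    p * sum (isSeenHeavy ∘ cls) + (q * sum (isNewHeavy ∘ cls) + (r * sum (isExtra ∘ cls) +
      (s * sum (isSeenLight ∘ cls) + t * sum (isNewLight ∘ cls))))
  sum-pick {n} p q r s t cls =
    trans (sum-cong-≋ (pointwise ∘ cls))
      (pull p _ (pull q _ (pull r _ (pull s _ (sym (*-distribˡ-sum t (isNewLight ∘ cls)))))))
    where
    pull : ∀ x (f : Fin n → Carrier) {g : Fin n → Carrier} {y} → sum g ≈ y →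
           sum (λ i → x * f i + g i) ≈ x * sum f + y
    pull x f {g} eq = trans (∑-distrib-+ (λ i → x * f i) g) (+-cong (sym (*-distribˡ-sum x f)) eq)
    pointwise : ∀ x → pick p q r s t x ≈
      p * isSeenHeavy x + (q * isNewHeavy x + (r * isExtra x + (s * isSeenLight x + t * isNewLight x)))
    pointwise seenHeavy = solve 5 (λ p q r s t → p := p :* :1 :+ (q :* :0 :+ (r :* :0 :+ (s :* :0 :+ t :* :0)))) refl p q r s t
    pointwise newHeavy  = solve 5 (λ p q r s t → q := p :* :0 :+ (q :* :1 :+ (r :* :0 :+ (s :* :0 :+ t :* :0)))) refl p q r s t
    pointwise extra     = solve 5 (λ p q r s t → r := p :* :0 :+ (q :* :0 :+ (r :* :1 :+ (s :* :0 :+ t :* :0)))) refl p q r s t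
    pointwise seenLight = solve 5 (λ p q r s t → s := p :* :0 :+ (q :* :0 :+ (r :* :0 :+ (s :* :1 :+ t :* :0)))) refl p q r s t
    pointwise newLight  = solve 5 (λ p q r s t → t := p :* :0 :+ (q :* :0 :+ (r :* :0 :+ (s :* :0 :+ t :* :1)))) refl p q r s t

  indicator : Bool → Carrier
  indicator b = if b then 1# else 0#

  indicator-nonNegative : ∀ b → 0# ≤ indicator b
  indicator-nonNegative true  = 0≤1
  indicator-nonNegative false = ≤-refl

  sum-≡-indicator : ∀ {n} (y : Fin n) → sum (λ x → indicator (does (x Fin.≟ y))) ≈ 1#
  sum-≡-indicator {suc n} Fin.zero    = trans (+-congˡ (sum-replicate-zero n)) (+-identityʳ 1#)
  sum-≡-indicator {suc n} (Fin.suc y) = trans (+-identityˡ _) (sum-≡-indicator y)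

  module _ {n : ℕ} where
    open DecMembership (Fin._≟_ {n}) public using (_∈?_)

    sum-∈-indicator : ∀ {k} (v : Vec (Fin n) k) → sum (λ x → indicator (does (x ∈? v))) ≤ fromℕ k
    sum-∈-indicator []              = ≤-reflexive (sum-replicate-zero n)
    sum-∈-indicator {suc k} (y ∷ v) = ≤-trans (sum-mono pointwise)
      (≤-respˡ (sym (∑-distrib-+ (λ x → indicator (does (x Fin.≟ y))) (λ x → indicator (does (x ∈? v)))))
        (+-mono-≤ (≤-reflexive (sum-≡-indicator y)) (sum-∈-indicator v)))
      where
      pointwise : ∀ x → indicator (does (x ∈? (y ∷ v))) ≤
                        indicator (does (x Fin.≟ y)) + indicator (does (x ∈? v))
      pointwise x with does (x Fin.≟ y) | does (x ∈? v)
      ... | true  | b     = ≤-respˡ (+-identityʳ 1#) (+-mono-≤ ≤-refl (indicator-nonNegative b))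
      ... | false | true  = ≤-reflexive (sym (+-identityˡ 1#))
      ... | false | false = ≤-reflexive (sym (+-identityˡ 0#))

-- The two instances and the induction over the algorithm

module TwoPoint {c ℓ₁ ℓ₂} (R : RealField c ℓ₁ ℓ₂) where
  open RealField R hiding (zero)
  open OrderedField R
  open Hybrid R
  open Sampling R
  open Scalars R
  open Classes R

  -- `sum-kind` encodes that there are `h` heavy, `d` extra and `z` light items. `2m≤h` and `h+m≤z`
  -- keep at least `h / 2` heavy and `h` light items new at all times, and `x` bounds the divergence
  -- contributed by a sample of either type.
  module Instances
    {n : ℕ} (kind : Fin n → Kind) (h d z x ε : Carrier) (m : ℕ)
    (sum-kind : ∀ p q r → sum (pickKind p q r ∘ kind) ≈ p * h + (q * d + r * z))
    (0<h : 0# < h) (0≤d : 0# ≤ d) (0≤x : 0# ≤ x)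
    (2m≤h : fromℕ 2 * fromℕ m ≤ h)
    (h+m≤z : h + fromℕ m ≤ z)
    (2d²m≤xh³ : fromℕ 2 * (d * d) * fromℕ m ≤ x * (h * h * h))
    (4d²≤xnh : fromℕ 4 * (d * d) ≤ x * (fromℕ n * h))
    (8mx≤1 : fromℕ 8 * (fromℕ m * x) ≤ 1#)
    (separated : (1# + ε) * h < (1# - ε) * (h + d))
    where

    n≈h+d+z : fromℕ n ≈ h + (d + z)
    n≈h+d+z = trans (sym (sum-replicate n)) (trans (sum-cong-≋ (pointwise ∘ kind)) (trans (sum-kind 1# 1# 1#)
      (solve 3 (λ h d z → :1 :* h :+ (:1 :* d :+ :1 :* z) := h :+ (d :+ z)) refl h d z)))
      where
      pointwise : ∀ k → 1# ≈ pickKind 1# 1# 1# k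
      pointwise heavy = refl
      pointwise extra = refl
      pointwise light = refl

    w₁ w₂ : Kind → Carrier
    w₁ = pickKind 1# 0# 0#
    w₂ = pickKind 1# 1# 0#

    W₁≈h : sum (w₁ ∘ kind) ≈ h
    W₁≈h = trans (sum-kind 1# 0# 0#)
      (solve 3 (λ h d z → :1 :* h :+ (:0 :* d :+ :0 :* z) := h) refl h d z)

    W₂≈h+d : sum (w₂ ∘ kind) ≈ h + d
    W₂≈h+d = trans (sum-kind 1# 1# 0#)
      (solve 3 (λ h d z → :1 :* h :+ (:1 :* d :+ :0 :* z) := h :+ d) refl h d z)

    0<h+d : 0# < h + d
    0<h+d = <-≤-trans 0<h (≤-respˡ (+-identityʳ h) (+-mono-≤ ≤-refl 0≤d))

    pickKind-nonNegative : ∀ {p q r} → 0# ≤ p → 0# ≤ q → 0# ≤ r → ∀ k → 0# ≤ pickKind p q r k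
    pickKind-nonNegative p q r heavy = p
    pickKind-nonNegative p q r extra = q
    pickKind-nonNegative p q r light = r

    extra-or-common : ∀ k → k ≡ extra ⊎ (k ≢ extra × w₁ k ≡ w₂ k)
    extra-or-common heavy = inj₂ ((λ ()) , ≡.refl)
    extra-or-common extra = inj₁ ≡.refl
    extra-or-common light = inj₂ ((λ ()) , ≡.refl)

    I₁ I₂ : Instance n
    I₁ = record
      { weight             = w₁ ∘ kind
      ; weight-nonNegative = pickKind-nonNegative 0≤1 ≤-refl ≤-refl ∘ kind
      ; W-positive         = <-≤-trans 0<h (≤-reflexive (sym W₁≈h))
      }
    I₂ = record
      { weight             = w₂ ∘ kind
      ; weight-nonNegative = pickKind-nonNegative 0≤1 0≤1 ≤-refl ∘ kind
      ; W-positive         = <-≤-trans 0<h+d (≤-reflexive (sym W₂≈h+d))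
      }

    P₁ P₂ : ∀ {r k} → Algorithm r k → Vec (Fin n) k → Carrier
    P₁ = successProbability I₁ ε
    P₂ = successProbability I₂ ε

    disjoint : ∀ Ŵ → IsApproximation I₁ ε Ŵ → ¬ IsApproximation I₂ ε Ŵ
    disjoint Ŵ (_ , Ŵ≤) (≤Ŵ , _) = <⇒≱ separated
      (≤-respˡ (*-congˡ W₂≈h+d) (≤-respʳ (*-congˡ W₁≈h) (≤-trans ≤Ŵ Ŵ≤)))

    -- A bound for (1 + x)^r.
    factor : ℕ → Carrier
    factor r = 1# + fromℕ 2 * (fromℕ r * x)

    1≤factor : ∀ r → 1# ≤ factor r
    1≤factor r = ≤-respˡ (+-identityʳ 1#)
      (+-mono-≤ ≤-refl (*-nonNegative (fromℕ-nonNegative 2) (*-nonNegative (fromℕ-nonNegative r) 0≤x)))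

    -- Comes down to `2 r x ≤ 1`, which `8mx≤1` gives for `r ≤ m`.
    factor-suc : ∀ {r} → r ℕ.≤ m → (1# + x) * factor r ≤ factor (suc r)
    factor-suc {r} r≤m = ≤-by
      (solve 3 (λ x r m → (:1 :+ :fromℕ 2 :* ((:1 :+ r) :* x)) :- (:1 :+ x) :* (:1 :+ :fromℕ 2 :* (r :* x)) :=
        x :* ((:1 :- :fromℕ 8 :* (m :* x)) :+ (:fromℕ 2 :* (x :* (m :- r)) :+ :fromℕ 6 :* (m :* x)))) refl x (fromℕ r) (fromℕ m))
      (*-nonNegative 0≤x (+-nonNegative (0≤y-x 8mx≤1) (+-nonNegative
        (*-nonNegative (fromℕ-nonNegative 2) (*-nonNegative 0≤x (0≤y-x (fromℕ-mono r≤m))))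
        (*-nonNegative (fromℕ-nonNegative 6) (*-nonNegative (fromℕ-nonNegative m) 0≤x)))))

    -- The invariant of the coupling: every item held has the same weight in both instances.
    Unextra : ∀ {k} → Vec (Fin n) k → Set
    Unextra = All (λ i → kind i ≢ extra)

    module Step {k} (v : Vec (Fin n) k) (unextra : Unextra v) (k≤m : k ℕ.≤ m) where

      class : Fin n → Class
      class i = classify (kind i) (does (i ∈? v))

      sH N e sL Z : Carrier
      sH = sum (isSeenHeavy ∘ class)
      N  = sum (isNewHeavy ∘ class)
      e  = sum (isExtra ∘ class)
      sL = sum (isSeenLight ∘ class)
      Z  = sum (isNewLight ∘ class)

      0≤sH : 0# ≤ sH
      0≤sH = sum-nonNegative (pick-nonNegative 0≤1 ≤-refl ≤-refl ≤-refl ≤-refl ∘ class)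

      0≤sL : 0# ≤ sL
      0≤sL = sum-nonNegative (pick-nonNegative ≤-refl ≤-refl ≤-refl 0≤1 ≤-refl ∘ class)

      sum-class : ∀ p q r → p * sH + (p * N + (q * e + (r * sL + r * Z))) ≈ p * h + (q * d + r * z)
      sum-class p q r = trans (sym (sum-pick p p q r r class))
        (trans (sum-cong-≋ λ i → pointwise (kind i) (does (i ∈? v))) (sum-kind p q r))
        where
        pointwise : ∀ k b → pick p p q r r (classify k b) ≈ pickKind p q r k
        pointwise heavy true  = refl
        pointwise heavy false = refl
        pointwise extra b     = refl
        pointwise light true  = refl
        pointwise light false = refl

      sH+N≈h : sH + N ≈ h
      sH+N≈h = trans
        (solve 5 (λ s N e l Z → s :+ N := :1 :* s :+ (:1 :* N :+ (:0 :* e :+ (:0 :* l :+ :0 :* Z)))) refl sH N e sL Z)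
        (trans (sum-class 1# 0# 0#) (solve 3 (λ h d z → :1 :* h :+ (:0 :* d :+ :0 :* z) := h) refl h d z))

      e≈d : e ≈ d
      e≈d = trans
        (solve 5 (λ s N e l Z → e := :0 :* s :+ (:0 :* N :+ (:1 :* e :+ (:0 :* l :+ :0 :* Z)))) refl sH N e sL Z)
        (trans (sum-class 0# 1# 0#) (solve 3 (λ h d z → :0 :* h :+ (:1 :* d :+ :0 :* z) := d) refl h d z))

      sL+Z≈z : sL + Z ≈ z
      sL+Z≈z = trans
        (solve 5 (λ s N e l Z → l :+ Z := :0 :* s :+ (:0 :* N :+ (:0 :* e :+ (:1 :* l :+ :1 :* Z)))) refl sH N e sL Z)
        (trans (sum-class 0# 0# 1#) (solve 3 (λ h d z → :0 :* h :+ (:0 :* d :+ :1 :* z) := z) refl h d z))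

      sH+sL≤m : sH + sL ≤ fromℕ m
      sH+sL≤m = ≤-trans
        (≤-respˡ (trans (sum-pick 1# 0# 0# 1# 0# class)
            (solve 5 (λ s N e l Z → :1 :* s :+ (:0 :* N :+ (:0 :* e :+ (:1 :* l :+ :0 :* Z))) := s :+ l) refl sH N e sL Z))
          (sum-mono λ i → pointwise (kind i) (does (i ∈? v))))
        (≤-trans (sum-∈-indicator v) (fromℕ-mono k≤m))
        where
        pointwise : ∀ k b → pick 1# 0# 0# 1# 0# (classify k b) ≤ indicator b
        pointwise heavy true  = ≤-refl
        pointwise heavy false = ≤-refl
        pointwise extra b     = indicator-nonNegative b
        pointwise light true  = ≤-refl
        pointwise light false = ≤-refl

      sH≤m : sH ≤ fromℕ m
      sH≤m = ≤-trans (≤-respˡ (+-identityʳ sH) (+-mono-≤ ≤-refl 0≤sL)) sH+sL≤m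

      sL≤m : sL ≤ fromℕ m
      sL≤m = ≤-trans (≤-respˡ (+-identityˡ sL) (+-mono-≤ 0≤sH ≤-refl)) sH+sL≤m

      h≤2N : h ≤ fromℕ 2 * N
      h≤2N = ≤-by₁ {u = - fromℕ 2}
        (solve 4 (λ h s N m → :fromℕ 2 :* N :- h :=
          ((h :- :fromℕ 2 :* m) :+ :fromℕ 2 :* (m :- s)) :+ (:- :fromℕ 2) :* (h :- (s :+ N))) refl h sH N (fromℕ m))
        (sym sH+N≈h)
        (+-nonNegative (0≤y-x 2m≤h) (*-nonNegative (fromℕ-nonNegative 2) (0≤y-x sH≤m)))

      h≤Z : h ≤ Z
      h≤Z = ≤-by₁ {u = 1#}
        (solve 5 (λ h z s Z m → Z :- h := ((z :- (h :+ m)) :+ (m :- s)) :+ :1 :* ((s :+ Z) :- z)) refl h z sL Z (fromℕ m))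
        sL+Z≈z (+-nonNegative (0≤y-x h+m≤z) (0≤y-x sL≤m))

      0<Z : 0# < Z
      0<Z = <-≤-trans 0<h h≤Z

      0<2 : 0# < fromℕ 2
      0<2 = fromℕ-positive 1

      0<N : 0# < N
      0<N = *-cancelˡ-0≤ 0<2 (≤-trans (proj₁ 0<h) h≤2N) ,
        λ 0≈N → <⇒≱ 0<h (≤-respʳ (trans (*-congˡ (sym 0≈N)) (zeroʳ (fromℕ 2))) h≤2N)

      t₁ t₂ : Carrier
      t₁ = d * Z ⁻¹
      t₂ = d * N ⁻¹

      0≤t₁ : 0# ≤ t₁
      0≤t₁ = *-nonNegative 0≤d (proj₁ (⁻¹-positive 0<Z))

      0≤t₂ : 0# ≤ t₂
      0≤t₂ = *-nonNegative 0≤d (proj₁ (⁻¹-positive 0<N))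

      div-mul : ∀ {y} → 0# < y → d * y ⁻¹ * y ≈ d
      div-mul {y} 0<y = trans (solve 3 (λ d i y → d :* i :* y := d :* (y :* i)) refl d (y ⁻¹) y)
        (trans (*-congˡ (⁻¹-inverse 0<y)) (*-identityʳ d))

      t₁Z≈d : t₁ * Z ≈ d
      t₁Z≈d = div-mul 0<Z

      t₂N≈d : t₂ * N ≈ d
      t₂N≈d = div-mul 0<N

      class-extra : ∀ {i} → class i ≡ extra → kind i ≡ extra
      class-extra {i} eq with kind i | does (i ∈? v)
      ... | extra | _ = ≡.refl
      class-extra () | heavy | true
      class-extra () | heavy | false
      class-extra () | light | true
      class-extra () | light | false

      class-of-extra : ∀ {i} → kind i ≡ extra → class i ≡ extra
      class-of-extra {i} eq = ≡.cong (λ k → classify k (does (i ∈? v))) eq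

      extra∉v : ∀ {i} → class i ≡ extra → i ∉ v
      extra∉v eq i∈v = All.lookup unextra i∈v (class-extra eq)

      class-newHeavy : ∀ {i} → class i ≡ newHeavy → kind i ≡ heavy × i ∉ v
      class-newHeavy {i} eq with kind i | i ∈? v
      ... | heavy | no i∉v = ≡.refl , i∉v
      class-newHeavy () | heavy | yes _
      class-newHeavy () | extra | _
      class-newHeavy () | light | yes _
      class-newHeavy () | light | no _

      class-newLight : ∀ {i} → class i ≡ newLight → kind i ≡ light × i ∉ v
      class-newLight {i} eq with kind i | i ∈? v
      ... | light | no i∉v = ≡.refl , i∉v
      class-newLight () | light | yes _
      class-newLight () | extra | _
      class-newLight () | heavy | yes _
      class-newLight () | heavy | no _

      -- Brings agreement on the supports into the product form that `sum-exchange` takes: off the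
      -- supports both sides vanish.
      agree-on-supports : ∀ {g : Class → Carrier} {T} → (∀ s → s ≡ T ⊎ g s ≡ 0#) →
        (f : Fin n → Carrier) → (∀ i j → class i ≡ T → class j ≡ extra → f i ≈ f j) →
        ∀ i j → g (class i) * isExtra (class j) * f i ≈ g (class i) * isExtra (class j) * f j
      agree-on-supports {g} {T} support f f-agree i j = agree (support (class i)) (supportExtra (class j))
        where
        supportExtra : ∀ s → s ≡ extra ⊎ isExtra s ≡ 0#
        supportExtra seenHeavy = inj₂ ≡.refl
        supportExtra newHeavy  = inj₂ ≡.refl
        supportExtra extra     = inj₁ ≡.refl
        supportExtra seenLight = inj₂ ≡.refl
        supportExtra newLight  = inj₂ ≡.refl
        both-zero : ∀ {u y z} → u ≈ 0# → u * y ≈ u * z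
        both-zero u≈0 = trans (*-congʳ u≈0) (trans (zeroˡ _) (sym (trans (*-congʳ u≈0) (zeroˡ _))))
        agree : class i ≡ T ⊎ g (class i) ≡ 0# → class j ≡ extra ⊎ isExtra (class j) ≡ 0# →
                g (class i) * isExtra (class j) * f i ≈ g (class i) * isExtra (class j) * f j
        agree (inj₁ i∈T)  (inj₁ j∈e)  = *-congˡ (f-agree i j i∈T j∈e)
        agree (inj₂ gi≡0) _           = both-zero (trans (*-congʳ (reflexive gi≡0)) (zeroˡ _))
        agree (inj₁ _)    (inj₂ ej≡0) = both-zero (trans (*-congˡ (reflexive ej≡0)) (zeroʳ _))

      module _ {r} (next : Carrier → Algorithm r (suc k)) (r≤m : r ℕ.≤ m)
        -- Asked for all `a`, `b`, `c`, as the likelihoods after the draw depend on the class of the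
        -- item drawn.
        (bound-next : ∀ w i → kind i ≢ extra → ∀ {a b c} → 0# ≤ a → 0# ≤ c → b * b ≤ a * c →
          Bound a b c (factor r) (P₁ (next w) (i ∷ v)) (P₂ (next w) (i ∷ v)))
        where

        f₁ f₂ : Fin n → Carrier
        f₁ i = P₁ (next (w₁ (kind i))) (i ∷ v)
        f₂ i = P₂ (next (w₂ (kind i))) (i ∷ v)

        f₁-agree : ∀ i j → class i ≡ newLight → class j ≡ extra → f₁ i ≈ f₁ j
        f₁-agree i j i-new j-extra with class-newLight i-new
        ... | i-light , i∉v = fresh-successProbability I₁ ε next
          (≡.trans (≡.cong w₁ i-light) (≡.sym (≡.cong w₁ (class-extra j-extra)))) i∉v (extra∉v j-extra)

        f₂-agree : ∀ i j → class i ≡ newHeavy → class j ≡ extra → f₂ i ≈ f₂ j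
        f₂-agree i j i-new j-extra with class-newHeavy i-new
        ... | i-heavy , i∉v = fresh-successProbability I₂ ε next
          (≡.trans (≡.cong w₂ i-heavy) (≡.sym (≡.cong w₂ (class-extra j-extra)))) i∉v (extra∉v j-extra)

        -- μ₁ and μ₂ are the laws of the sample under I₁ and I₂. As the extra items are
        -- indistinguishable from new light items under I₁, and from new heavy items under I₂,
        -- their probability may be moved there, which gives the laws q and p.
        Bound-sample : ∀ {μ₁ μ₂ : Kind → Carrier} (q p κ : Class → Carrier) →
          q extra ≡ 0# → p extra ≡ 0# → κ extra ≡ 0# →
          (∀ s → 0# ≤ q s) → (∀ s → 0# ≤ κ s) → (∀ s → p s * p s ≤ q s * κ s) →
          sum (μ₁ ∘ kind) ≈ 1# → sum (μ₂ ∘ kind) ≈ 1# →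
          (∀ k b → μ₁ k + t₁ * μ₁ extra * isNewLight (classify k b) ≈
                   q (classify k b) + μ₁ extra * isExtra (classify k b)) →
          (∀ k b → μ₂ k + t₂ * μ₂ extra * isNewHeavy (classify k b) ≈
                   p (classify k b) + μ₂ extra * isExtra (classify k b)) →
          sum (κ ∘ class) ≤ 1# + x →
          ∀ {a b c} → 0# ≤ a → 0# ≤ c → b * b ≤ a * c →
          Bound a b c (factor (suc r)) (sum (λ i → μ₁ (kind i) * f₁ i)) (sum (λ i → μ₂ (kind i) * f₂ i))
        Bound-sample {μ₁} {μ₂} q p κ q-extra p-extra κ-extra 0≤q 0≤κ p²≤qκ Σμ₁≈1 Σμ₂≈1 moved₁ moved₂ Σκ≤1+x
          {a} {b} {c} 0≤a 0≤c b²≤ac =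
          Bound-cong (redistribute₁ f₁ f₁-agree) (redistribute₂ f₂ f₂-agree)
            (Bound-mono 0≤c (factor-suc r≤m)
              (Bound-sum (q ∘ class) (p ∘ class) (κ ∘ class) f₁ f₂
                (total redistribute₁ Σμ₁≈1) (total redistribute₂ Σμ₂≈1) Σκ≤1+x
                (*-nonNegative 0≤c (≤-trans 0≤1 (1≤factor r))) pointwise))
          where
          redistribute₁ : ∀ f → (∀ i j → class i ≡ newLight → class j ≡ extra → f i ≈ f j) →
            sum (λ i → μ₁ (kind i) * f i) ≈ sum (λ i → q (class i) * f i)
          redistribute₁ f f-agree = sum-redistribute (isNewLight ∘ class) (isExtra ∘ class) (μ₁ ∘ kind) (q ∘ class) f
            (agree-on-supports support f f-agree) 0<Z (trans t₁Z≈d (sym e≈d)) (λ i → moved₁ (kind i) _)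
            where
            support : ∀ s → s ≡ newLight ⊎ isNewLight s ≡ 0#
            support seenHeavy = inj₂ ≡.refl
            support newHeavy  = inj₂ ≡.refl
            support extra     = inj₂ ≡.refl
            support seenLight = inj₂ ≡.refl
            support newLight  = inj₁ ≡.refl
          redistribute₂ : ∀ f → (∀ i j → class i ≡ newHeavy → class j ≡ extra → f i ≈ f j) →
            sum (λ i → μ₂ (kind i) * f i) ≈ sum (λ i → p (class i) * f i)
          redistribute₂ f f-agree = sum-redistribute (isNewHeavy ∘ class) (isExtra ∘ class) (μ₂ ∘ kind) (p ∘ class) f
            (agree-on-supports support f f-agree) 0<N (trans t₂N≈d (sym e≈d)) (λ i → moved₂ (kind i) _)
            where
            support : ∀ s → s ≡ newHeavy ⊎ isNewHeavy s ≡ 0#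
            support seenHeavy = inj₂ ≡.refl
            support newHeavy  = inj₁ ≡.refl
            support extra     = inj₂ ≡.refl
            support seenLight = inj₂ ≡.refl
            support newLight  = inj₂ ≡.refl
          -- Redistribution preserves the expectation of the constant 1, so the new law still has
          -- mass 1.
          total : ∀ {T} {μ q : Fin n → Carrier} →
            (∀ f → (∀ i j → class i ≡ T → class j ≡ extra → f i ≈ f j) → sum (λ i → μ i * f i) ≈ sum (λ i → q i * f i)) →
            sum μ ≈ 1# → sum q ≈ 1#
          total {μ = μ} {q} redistribute Σμ≈1 =
            trans (sum-cong-≋ (λ i → sym (*-identityʳ (q i))))
              (trans (sym (redistribute (λ _ → 1#) (λ _ _ _ _ → refl)))
                (trans (sum-cong-≋ (λ i → *-identityʳ (μ i))) Σμ≈1))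
          pointwise : ∀ i → Bound (a * q (class i)) (b * p (class i)) (c * κ (class i)) (factor r) (f₁ i) (f₂ i)
          pointwise i with extra-or-common (kind i)
          ... | inj₁ i-extra rewrite class-of-extra i-extra | q-extra | p-extra | κ-extra =
            Bound-zero a b c (factor r) (f₁ i) (f₂ i)
          -- Both instances return the same weight for this item, so both executions continue with
          -- the same subtree and the induction hypothesis applies.
          ... | inj₂ (i≢extra , w₁≡w₂) =
            ≡.subst (λ w → Bound _ _ _ (factor r) (f₁ i) (P₂ (next w) (i ∷ v))) w₁≡w₂
              (bound-next (w₁ (kind i)) i i≢extra (*-nonNegative 0≤a (0≤q s)) (*-nonNegative 0≤c (0≤κ s))
                (≤-respˡ (solve 2 (λ b p → b :* b :* (p :* p) := b :* p :* (b :* p)) refl b (p s))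
                  (≤-respʳ (solve 4 (λ a c q k → a :* c :* (q :* k) := a :* q :* (c :* k)) refl a c (q s) (κ s))
                    (*-mono-≤ (square-nonNegative (p s)) (*-nonNegative 0≤a 0≤c) b²≤ac (p²≤qκ s)))))
            where s = class i

        private
          ν η ω : Carrier
          ν = 1# / fromℕ n
          η = Instance.W I₁ ⁻¹
          ω = Instance.W I₂ ⁻¹

          0<n : 0# < fromℕ n
          0<n = <-≤-trans 0<h (≤-respˡ (+-identityʳ h) (≤-respʳ (sym n≈h+d+z)
            (+-mono-≤ ≤-refl (+-nonNegative 0≤d (≤-trans (+-nonNegative (proj₁ 0<h) (fromℕ-nonNegative m)) h+m≤z)))))

          nν≈1 : fromℕ n * ν ≈ 1#
          nν≈1 = trans (*-congˡ (*-identityˡ _)) (⁻¹-inverse 0<n)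

          0≤ν : 0# ≤ ν
          0≤ν = *-nonNegative 0≤1 (proj₁ (⁻¹-positive 0<n))

          0≤η : 0# ≤ η
          0≤η = proj₁ (⁻¹-positive (Instance.W-positive I₁))

          hη≈1 : h * η ≈ 1#
          hη≈1 = trans (*-congʳ (sym W₁≈h)) (⁻¹-inverse (Instance.W-positive I₁))

          [h+d]ω≈1 : (h + d) * ω ≈ 1#
          [h+d]ω≈1 = trans (*-congʳ (sym W₂≈h+d)) (⁻¹-inverse (Instance.W-positive I₂))

        Bound-uniform : ∀ {a b c} → 0# ≤ a → 0# ≤ c → b * b ≤ a * c →
          Bound a b c (factor (suc r)) (P₁ (uniform next) v) (P₂ (uniform next) v)
        Bound-uniform = Bound-sample {λ _ → ν} {λ _ → ν} q p κ ≡.refl ≡.refl ≡.refl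
          (pick-nonNegative 0≤ν 0≤ν ≤-refl 0≤ν (*-nonNegative 0≤ν (+-nonNegative 0≤1 0≤t₁)))
          (pick-nonNegative 0≤ν (*-nonNegative 0≤ν (square-nonNegative _)) ≤-refl 0≤ν
            (*-nonNegative 0≤ν 0≤1-t₁+t₁²))
          p²≤qκ
          Σν≈1 Σν≈1 moved₁ moved₂
          (≤-respˡ (sym (trans (sum-pick ν _ 0# ν _ class)
              (solve 4 (λ u y e w → u :+ (y :+ (:0 :* e :+ w)) := u :+ (y :+ w)) refl _ _ e _)))
            (uniform-χ² 0<h 0≤d 0≤t₂ sH+N≈h t₂N≈d h≤2N 0≤t₁ t₁Z≈d 0≤ν nν≈1 n≈h+d+z sL+Z≈z h≤Z 4d²≤xnh))
          where
          q p κ : Class → Carrier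
          q = pick ν ν 0# ν (ν * (1# + t₁))
          p = pick ν (ν * (1# + t₂)) 0# ν ν
          κ = pick ν (ν * ((1# + t₂) * (1# + t₂))) 0# ν (ν * (1# - t₁ + t₁ * t₁))
          0≤1-t₁+t₁² : 0# ≤ 1# - t₁ + t₁ * t₁
          0≤1-t₁+t₁² = ≤-respʳ
            (solve 1 (λ t → (:1 :- t) :* (:1 :- t) :+ t := :1 :- t :+ t :* t) refl t₁)
            (+-nonNegative (square-nonNegative (1# - t₁)) 0≤t₁)
          p²≤qκ : ∀ s → p s * p s ≤ q s * κ s
          p²≤qκ seenHeavy = ≤-refl
          p²≤qκ newHeavy  = ≤-reflexive
            (solve 2 (λ ν t → ν :* t :* (ν :* t) := ν :* (ν :* (t :* t))) refl ν (1# + t₂))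
          p²≤qκ extra     = ≤-refl
          p²≤qκ seenLight = ≤-refl
          -- `(1 + t) (1 - t + t²) = 1 + t³`.
          p²≤qκ newLight  = ≤-by
            (solve 2 (λ ν t → ν :* (:1 :+ t) :* (ν :* (:1 :- t :+ t :* t)) :- ν :* ν := ν :* ν :* (t :* t :* t))
              refl ν t₁)
            (*-nonNegative (square-nonNegative ν) (*-nonNegative (square-nonNegative t₁) 0≤t₁))
          Σν≈1 : sum {n} (λ _ → ν) ≈ 1#
          Σν≈1 = trans (sum-cong-≋ {n} (λ _ → sym (*-identityʳ ν)))
            (trans (sym (*-distribˡ-sum {n} ν (λ _ → 1#)))
              (trans (*-congˡ (sum-replicate n)) (trans (*-comm ν _) nν≈1)))
          unmoved : ∀ y → ν + y * ν * 0# ≈ ν + ν * 0#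
          unmoved y = solve 2 (λ y ν → ν :+ y :* ν :* :0 := ν :+ ν :* :0) refl y ν
          moved-from : ∀ y → ν + y * ν * 0# ≈ 0# + ν * 1#
          moved-from y = solve 2 (λ y ν → ν :+ y :* ν :* :0 := :0 :+ ν :* :1) refl y ν
          moved-to : ∀ y → ν + y * ν * 1# ≈ ν * (1# + y) + ν * 0#
          moved-to y = solve 2 (λ y ν → ν :+ y :* ν :* :1 := ν :* (:1 :+ y) :+ ν :* :0) refl y ν
          moved₁ : ∀ k b → ν + t₁ * ν * isNewLight (classify k b) ≈ q (classify k b) + ν * isExtra (classify k b)
          moved₁ heavy true  = unmoved t₁
          moved₁ heavy false = unmoved t₁
          moved₁ extra b     = moved-from t₁
          moved₁ light true  = unmoved t₁
          moved₁ light false = moved-to t₁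
          moved₂ : ∀ k b → ν + t₂ * ν * isNewHeavy (classify k b) ≈ p (classify k b) + ν * isExtra (classify k b)
          moved₂ heavy true  = unmoved t₂
          moved₂ heavy false = moved-to t₂
          moved₂ extra b     = moved-from t₂
          moved₂ light true  = unmoved t₂
          moved₂ light false = unmoved t₂

        Bound-proportional : ∀ {a b c} → 0# ≤ a → 0# ≤ c → b * b ≤ a * c →
          Bound a b c (factor (suc r)) (P₁ (proportional next) v) (P₂ (proportional next) v)
        Bound-proportional = Bound-sample {λ k → w₁ k * η} {λ k → w₂ k * ω} q p κ ≡.refl ≡.refl ≡.refl
          (pick-nonNegative 0≤η 0≤η ≤-refl ≤-refl ≤-refl)
          (pick-nonNegative (0≤h* ω) (0≤h* (ω * (1# + t₂))) ≤-refl ≤-refl ≤-refl)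
          p²≤qκ
          (Σ≈1 I₁) (Σ≈1 I₂) moved₁ moved₂
          (≤-respˡ (sym (trans (sum-pick _ _ 0# 0# 0# class)
              (solve 5 (λ u y e w t → u :+ (y :+ (:0 :* e :+ (:0 :* w :+ :0 :* t))) := u :+ y) refl _ _ e sL Z)))
            (proportional-χ² 0<h 0≤d 0≤t₂ sH+N≈h t₂N≈d h≤2N [h+d]ω≈1 0≤x 0≤sH sH≤m 2d²m≤xh³))
          where
          q p κ : Class → Carrier
          q = pick η η 0# 0# 0#
          p = pick ω (ω * (1# + t₂)) 0# 0# 0#
          -- `q` equals `1 / h` on heavy items, so multiplying by `h` divides by `q`.
          κ = pick (h * (ω * ω)) (h * (ω * (1# + t₂) * (ω * (1# + t₂)))) 0# 0# 0#
          0≤h* : ∀ y → 0# ≤ h * (y * y)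
          0≤h* y = *-nonNegative (proj₁ 0<h) (square-nonNegative y)
          y²≤ηhy² : ∀ y → y * y ≤ η * (h * (y * y))
          y²≤ηhy² y = ≤-reflexive (sym (trans
            (solve 3 (λ η h y → η :* (h :* (y :* y)) := h :* η :* (y :* y)) refl η h y)
            (trans (*-congʳ hη≈1) (*-identityˡ (y * y)))))
          p²≤qκ : ∀ s → p s * p s ≤ q s * κ s
          p²≤qκ seenHeavy = y²≤ηhy² ω
          p²≤qκ newHeavy  = y²≤ηhy² (ω * (1# + t₂))
          p²≤qκ extra     = ≤-refl
          p²≤qκ seenLight = ≤-refl
          p²≤qκ newLight  = ≤-refl
          Σ≈1 : ∀ (I : Instance n) → sum (λ i → Instance.weight I i * Instance.W I ⁻¹) ≈ 1#
          Σ≈1 I = trans (sym (*-distribʳ-sum (W ⁻¹) weight)) (⁻¹-inverse W-positive)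
            where open Instance I
          -- Extra items weigh nothing in the first instance, so here nothing is moved; only the
          -- second law changes.
          moved₁ : ∀ k b → w₁ k * η + t₁ * (0# * η) * isNewLight (classify k b) ≈
                           q (classify k b) + 0# * η * isExtra (classify k b)
          moved₁ heavy true  = solve 2 (λ t η → :1 :* η :+ t :* (:0 :* η) :* :0 := η :+ :0 :* η :* :0) refl t₁ η
          moved₁ heavy false = solve 2 (λ t η → :1 :* η :+ t :* (:0 :* η) :* :0 := η :+ :0 :* η :* :0) refl t₁ η
          moved₁ extra b     = solve 2 (λ t η → :0 :* η :+ t :* (:0 :* η) :* :0 := :0 :+ :0 :* η :* :1) refl t₁ η
          moved₁ light true  = solve 2 (λ t η → :0 :* η :+ t :* (:0 :* η) :* :0 := :0 :+ :0 :* η :* :0) refl t₁ η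
          moved₁ light false = solve 2 (λ t η → :0 :* η :+ t :* (:0 :* η) :* :1 := :0 :+ :0 :* η :* :0) refl t₁ η
          moved₂ : ∀ k b → w₂ k * ω + t₂ * (1# * ω) * isNewHeavy (classify k b) ≈
                           p (classify k b) + 1# * ω * isExtra (classify k b)
          moved₂ heavy true  = solve 2 (λ t ω → :1 :* ω :+ t :* (:1 :* ω) :* :0 := ω :+ :1 :* ω :* :0) refl t₂ ω
          moved₂ heavy false = solve 2 (λ t ω → :1 :* ω :+ t :* (:1 :* ω) :* :1 := ω :* (:1 :+ t) :+ :1 :* ω :* :0) refl t₂ ω
          moved₂ extra b     = solve 2 (λ t ω → :1 :* ω :+ t :* (:1 :* ω) :* :0 := :0 :+ :1 :* ω :* :1) refl t₂ ω
          moved₂ light true  = solve 2 (λ t ω → :0 :* ω :+ t :* (:1 :* ω) :* :0 := :0 :+ :1 :* ω :* :0) refl t₂ ω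
          moved₂ light false = solve 2 (λ t ω → :0 :* ω :+ t :* (:1 :* ω) :* :0 := :0 :+ :1 :* ω :* :0) refl t₂ ω

    -- a and b are the likelihoods of the transcript so far under I₁ and I₂, and c bounds b²/a.
    bound : ∀ {r k} (A : Algorithm r k) {v} → Unextra v → r ℕ.+ k ℕ.≤ m →
            ∀ {a b c} → 0# ≤ a → 0# ≤ c → b * b ≤ a * c →
            Bound a b c (factor r) (P₁ A v) (P₂ A v)
    bound {r} (output Ŵ) _ _ 0≤a 0≤c b²≤ac =
      Bound-indicators 0≤a 0≤c b²≤ac (1≤factor r) (isApproximation? I₁ ε Ŵ) (isApproximation? I₂ ε Ŵ) (disjoint Ŵ)
    bound {suc r} {k} (proportional next) {v} unextra r+k≤m =
      Step.Bound-proportional v unextra (ℕ.m+n≤o⇒n≤o (suc r) r+k≤m) next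
        (ℕ.m+n≤o⇒m≤o r (ℕ.≤-trans (ℕ.n≤1+n _) r+k≤m))
        (λ w i i≢extra → bound (next w) (i≢extra ∷ unextra) (≡.subst (ℕ._≤ m) (≡.sym (ℕ.+-suc r k)) r+k≤m))
    bound {suc r} {k} (uniform next) {v} unextra r+k≤m =
      Step.Bound-uniform v unextra (ℕ.m+n≤o⇒n≤o (suc r) r+k≤m) next
        (ℕ.m+n≤o⇒m≤o r (ℕ.≤-trans (ℕ.n≤1+n _) r+k≤m))
        (λ w i i≢extra → bound (next w) (i≢extra ∷ unextra) (≡.subst (ℕ._≤ m) (≡.sym (ℕ.+-suc r k)) r+k≤m))
    bound (compare i j next) unextra r+k≤m = bound (next _) unextra r+k≤m

    -- At `a = b = c = 1` the bound reads `8 (p₁ + p₂) ≤ 9 + 8 m x`, which is at most 10. The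
    -- resulting `5/4` lies below `2/3 + 2/3`.
    success-sum : ∀ (A : Algorithm m 0) → fromℕ 4 * (P₁ A [] + P₂ A []) ≤ fromℕ 5
    success-sum A = *-cancelˡ-≤ (fromℕ-positive 1) (≤-by
      (solve 4 (λ p₁ p₂ m x → :fromℕ 2 :* :fromℕ 5 :- :fromℕ 2 :* (:fromℕ 4 :* (p₁ :+ p₂)) :=
        ((:fromℕ 9 :* :1 :+ :fromℕ 4 :* (:1 :* (:1 :+ :fromℕ 2 :* (m :* x))))
          :- (:fromℕ 8 :* (:1 :* p₁ :+ :1 :* p₂) :+ :fromℕ 4 :* :1)) :+ (:1 :- :fromℕ 8 :* (m :* x)))
        refl (P₁ A []) (P₂ A []) (fromℕ m) x)
      (+-nonNegative
        (0≤y-x (bound A [] (ℕ.≤-reflexive (ℕ.+-identityʳ m)) 0≤1 0≤1 ≤-refl))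
        (0≤y-x 8mx≤1)))

-- Choice of the parameters

blocks : (h d : ℕ) {n : ℕ} → Fin n → Kind
blocks zero    zero    i           = light
blocks zero    (suc d) Fin.zero    = extra
blocks zero    (suc d) (Fin.suc i) = blocks zero d i
blocks (suc h) d       Fin.zero    = heavy
blocks (suc h) d       (Fin.suc i) = blocks h d i

n≤2^n : ∀ n → n ℕ.≤ 2 ℕ.^ n
n≤2^n zero    = ℕ.z≤n
n≤2^n (suc n) = ℕ.+-mono-≤ (ℕ.m^n>0 2 n) (ℕ.≤-trans (n≤2^n n) (ℕ.m≤m+n _ 0))

module Parameters {c ℓ₁ ℓ₂} (R : RealField c ℓ₁ ℓ₂) where
  open RealField R hiding (zero)
  open OrderedField R
  open Exp semiring using (^-congˡ)

  sum-blocks : ∀ h d z p q r → sum {h ℕ.+ (d ℕ.+ z)} (pickKind p q r ∘ blocks h d) ≈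
               p * fromℕ h + (q * fromℕ d + r * fromℕ z)
  sum-blocks zero zero zero p q r =
    solve 3 (λ p q r → :0 := p :* :0 :+ (q :* :0 :+ r :* :0)) refl p q r
  sum-blocks zero zero (suc z) p q r = trans (+-congˡ (sum-blocks zero zero z p q r))
    (solve 4 (λ p q r z → r :+ (p :* :0 :+ (q :* :0 :+ r :* z)) := p :* :0 :+ (q :* :0 :+ r :* (:1 :+ z)))
      refl p q r (fromℕ z))
  sum-blocks zero (suc d) z p q r = trans (+-congˡ (sum-blocks zero d z p q r))
    (solve 5 (λ p q r d z → q :+ (p :* :0 :+ (q :* d :+ r :* z)) := p :* :0 :+ (q :* (:1 :+ d) :+ r :* z))
      refl p q r (fromℕ d) (fromℕ z))
  sum-blocks (suc h) d z p q r = trans (+-congˡ (sum-blocks h d z p q r))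
    (solve 6 (λ p q r h d z → p :+ (p :* h :+ (q :* d :+ r :* z)) := p :* (:1 :+ h) :+ (q :* d :+ r :* z))
      refl p q r (fromℕ h) (fromℕ d) (fromℕ z))

  1≤*-≤ : ∀ {x y} → 1# ≤ x → 0# ≤ y → y ≤ x * y
  1≤*-≤ {x} {y} 1≤x 0≤y = ≤-by (solve 2 (λ x y → x :* y :- y := (x :- :1) :* y) refl x y)
    (*-nonNegative (0≤y-x 1≤x) 0≤y)

  1≤^ : ∀ {x} → 1# ≤ x → ∀ k → 1# ≤ x ^ k
  1≤^ 1≤x zero    = ≤-refl
  1≤^ 1≤x (suc k) = ≤-trans (1≤^ 1≤x k) (1≤*-≤ 1≤x (≤-trans 0≤1 (1≤^ 1≤x k)))

  1≤* : ∀ {x y} → 1# ≤ x → 1# ≤ y → 1# ≤ x * y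
  1≤* 1≤x 1≤y = ≤-trans 1≤y (1≤*-≤ 1≤x (≤-trans 0≤1 1≤y))

  1≤⇒0< : ∀ {x} → 1# ≤ x → 0# < x
  1≤⇒0< = <-≤-trans 0<1

  1≤fromℕ : ∀ {n} → 1 ℕ.≤ n → 1# ≤ fromℕ n
  1≤fromℕ 1≤n = ≤-respˡ (+-identityʳ 1#) (fromℕ-mono 1≤n)

  archimedean-multiple : ∀ {y} → 0# < y → ∀ x → ∃[ n ] 1 ℕ.≤ n × x ≤ y * fromℕ n
  archimedean-multiple {y} 0<y x with archimedean (x * y ⁻¹)
  ... | k , x/y≤k = suc k , ℕ.s≤s ℕ.z≤n ,
    ≤-trans (≤-by₁ {u = x}
      (solve 4 (λ x y i k → y :* k :- x := y :* (k :- x :* i) :+ x :* (y :* i :- :1)) refl x y (y ⁻¹) (fromℕ k))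
      (⁻¹-inverse 0<y) (*-nonNegative (proj₁ 0<y) (0≤y-x x/y≤k)))
      (*-monoʳ-≤ (proj₁ 0<y) (fromℕ-mono (ℕ.n≤1+n k)))

  fromℕ-cancel-≤ : ∀ {m n} → fromℕ m ≤ fromℕ n → m ℕ.≤ n
  fromℕ-cancel-≤ {m} {n} m≤n with m ℕ.≤? n
  ... | yes m≤n′ = m≤n′
  ... | no  m≰n  = ⊥-elim (<⇒≱ 0<1 (≤-by
    (solve 2 (λ m n → :0 :- :1 := (m :- (:1 :+ n)) :+ (n :- m)) refl (fromℕ m) (fromℕ n))
    (+-nonNegative (0≤y-x (fromℕ-mono (ℕ.≰⇒> m≰n))) (0≤y-x m≤n))))

  -- G is the least power of two with 1 ≤ ε G³, cut off at 2 ^ r.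
  dyadic-scale : ∀ {ε} → ε ≤ 1# → ∀ r → ∃[ q ] ∃[ G ]
    q ℕ.* G ≡ 2 ℕ.^ r × 1 ℕ.≤ q × 1 ℕ.≤ G ×
    ε * fromℕ G ^ 3 ≤ fromℕ 8 × (q ≡ 1 ⊎ 1# ≤ ε * fromℕ G ^ 3)
  dyadic-scale {ε} ε≤1 zero = 1 , 1 , ≡.refl , ℕ.≤-refl , ℕ.≤-refl ,
    ≤-by (solve 1 (λ ε → :fromℕ 8 :- ε :* :fromℕ 1 :^ 3 := (:1 :- ε) :+ :fromℕ 7) refl ε)
      (+-nonNegative (0≤y-x ε≤1) (fromℕ-nonNegative 7)) ,
    inj₁ ≡.refl
  dyadic-scale {ε} ε≤1 (suc r) with dyadic-scale ε≤1 r
  ... | q , G , qG≡2^r , 1≤q , 1≤G , εG³≤8 , cut with 1# ≤? ε * fromℕ G ^ 3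
  ...   | yes 1≤εG³ = 2 ℕ.* q , G , ≡.trans (ℕ.*-assoc 2 q G) (≡.cong (2 ℕ.*_) qG≡2^r) ,
                      ℕ.≤-trans 1≤q (ℕ.m≤m+n q _) , 1≤G , εG³≤8 , inj₂ 1≤εG³
  ...   | no  1≰εG³ with cut
  ...     | inj₂ 1≤εG³  = ⊥-elim (1≰εG³ 1≤εG³)
  -- Doubling `G` multiplies `ε G³`, so far below 1, by 8; hence the upper bound 8.
  ...     | inj₁ ≡.refl = 1 , 2 ℕ.* G ,
      ≡.trans (ℕ.+-identityʳ _) (≡.cong (2 ℕ.*_) (≡.trans (≡.sym (ℕ.+-identityʳ G)) qG≡2^r)) ,
      ℕ.≤-refl , ℕ.≤-trans 1≤G (ℕ.m≤m+n G _) ,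
      ≤-respˡ (*-congˡ (^-congˡ 3 (sym (fromℕ-* 2 G))))
        (≤-by (solve 2 (λ ε G → :fromℕ 8 :- ε :* (:fromℕ 2 :* G) :^ 3 := :fromℕ 8 :* (:1 :- ε :* G :^ 3)) refl ε (fromℕ G))
          (*-nonNegative (fromℕ-nonNegative 8) (0≤y-x (proj₁ (≰⇒> 1≰εG³))))) ,
      inj₁ ≡.refl

  -- With Q G = 2 ^ r and n = (C + 3) (Q G)⁶, and with G of order ε^(-1/3) or Q = 1, the values
  -- of h and d below are of order (n/ε)^(2/3) and ε h (with n^(-1/2) for ε if Q = 1).
  module Scale {Q G C M : Carrier} (1≤Q : 1# ≤ Q) (1≤G : 1# ≤ G) (1≤C : 1# ≤ C) (0≤M : 0# ≤ M)
    (64C²M≤Q²G⁶ : fromℕ 64 * C ^ 2 * M ≤ Q ^ 2 * G ^ 6) where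

    private
      h = Q ^ 4 * G ^ 6
      d = C * (Q ^ 4 * G ^ 3)
      Y = Q ^ 2 * G ^ 6
      n = (C + fromℕ 3) * (Q ^ 6 * G ^ 6)
      -- `Y` is the order of the threshold. Here `d² / (n h) = C² / ((C + 3) Y)` and
      -- `d² M / h³ = C² M / Y²`, so both contributions are `O(C² / Y)` for `M ≤ Y`.
      x = fromℕ 4 * C ^ 2 * Y ⁻¹

      1≤Y : 1# ≤ Y
      1≤Y = 1≤* (1≤^ 1≤Q 2) (1≤^ 1≤G 6)

      Yx≈4C² : Y * x ≈ fromℕ 4 * C ^ 2
      Yx≈4C² = trans (solve 3 (λ Y i C → Y :* (:fromℕ 4 :* C :^ 2 :* i) := :fromℕ 4 :* C :^ 2 :* (Y :* i)) refl Y (Y ⁻¹) C)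
        (trans (*-congˡ (⁻¹-inverse (1≤⇒0< 1≤Y))) (*-identityʳ _))

      0≤C : 0# ≤ C
      0≤C = ≤-trans 0≤1 1≤C

      0≤C² : 0# ≤ C ^ 2
      0≤C² = ≤-trans 0≤1 (1≤^ 1≤C 2)

      64M≤Y : fromℕ 64 * M ≤ Y
      64M≤Y = ≤-trans (1≤*-≤ (1≤^ 1≤C 2) (*-nonNegative (fromℕ-nonNegative 64) 0≤M))
        (≤-respˡ (solve 2 (λ C M → :fromℕ 64 :* C :^ 2 :* M := C :^ 2 :* (:fromℕ 64 :* M)) refl C M) 64C²M≤Q²G⁶)

      M≤Y : M ≤ Y
      M≤Y = ≤-trans (≤-by (solve 1 (λ M → :fromℕ 64 :* M :- M := :fromℕ 63 :* M) refl M)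
        (*-nonNegative (fromℕ-nonNegative 63) 0≤M)) 64M≤Y

      Y≤h : Y ≤ h
      Y≤h = ≤-respʳ (solve 2 (λ Q G → Q :^ 2 :* (Q :^ 2 :* G :^ 6) := Q :^ 4 :* G :^ 6) refl Q G)
        (1≤*-≤ (1≤^ 1≤Q 2) (≤-trans 0≤1 1≤Y))

      h≤Q⁶G⁶ : h ≤ Q ^ 6 * G ^ 6
      h≤Q⁶G⁶ = ≤-respʳ (solve 2 (λ Q G → Q :^ 2 :* (Q :^ 4 :* G :^ 6) := Q :^ 6 :* G :^ 6) refl Q G)
        (1≤*-≤ (1≤^ 1≤Q 2) (≤-trans 0≤1 (≤-trans 1≤Y Y≤h)))

      1≤Q⁴G³ : 1# ≤ Q ^ 4 * G ^ 3
      1≤Q⁴G³ = 1≤* (1≤^ 1≤Q 4) (1≤^ 1≤G 3)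

      Q⁴G³≤Q⁶G⁶ : Q ^ 4 * G ^ 3 ≤ Q ^ 6 * G ^ 6
      Q⁴G³≤Q⁶G⁶ = ≤-respʳ (solve 2 (λ Q G → (Q :^ 2 :* G :^ 3) :* (Q :^ 4 :* G :^ 3) := Q :^ 6 :* G :^ 6) refl Q G)
        (1≤*-≤ (1≤* (1≤^ 1≤Q 2) (1≤^ 1≤G 3)) (≤-trans 0≤1 1≤Q⁴G³))

    0<h : 0# < h
    0<h = 1≤⇒0< (≤-trans 1≤Y Y≤h)

    0≤d : 0# ≤ d
    0≤d = *-nonNegative 0≤C (≤-trans 0≤1 1≤Q⁴G³)

    0≤x : 0# ≤ x
    0≤x = *-nonNegative (*-nonNegative (fromℕ-nonNegative 4) 0≤C²) (proj₁ (⁻¹-positive (1≤⇒0< 1≤Y)))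

    2M≤h : fromℕ 2 * M ≤ h
    2M≤h = ≤-trans (≤-by (solve 1 (λ M → :fromℕ 64 :* M :- :fromℕ 2 :* M := :fromℕ 62 :* M) refl M)
      (*-nonNegative (fromℕ-nonNegative 62) 0≤M)) (≤-trans 64M≤Y Y≤h)

    -- The origin of `C + 3`: each of `h`, `h` and `M` is at most `Q⁶ G⁶`, and `d` is at most `C`
    -- times that.
    2h+d+M≤n : h + M + (h + d) ≤ n
    2h+d+M≤n = ≤-by
      (solve 5 (λ h M u C X → (C :+ :fromℕ 3) :* X :- (h :+ M :+ (h :+ C :* u)) :=
        (:fromℕ 2 :* (X :- h) :+ (X :- M)) :+ C :* (X :- u)) refl h M (Q ^ 4 * G ^ 3) C (Q ^ 6 * G ^ 6))
      (+-nonNegative (+-nonNegative (*-nonNegative (fromℕ-nonNegative 2) (0≤y-x h≤Q⁶G⁶))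
          (0≤y-x (≤-trans M≤Y (≤-trans Y≤h h≤Q⁶G⁶))))
        (*-nonNegative 0≤C (0≤y-x Q⁴G³≤Q⁶G⁶)))

    2d²M≤xh³ : fromℕ 2 * (d * d) * M ≤ x * (h * h * h)
    2d²M≤xh³ = ≤-by₁ {u = Q ^ 10 * G ^ 12}
      (solve 5 (λ Q G C M x →
        let h = Q :^ 4 :* G :^ 6
            d = C :* (Q :^ 4 :* G :^ 3)
            Y = Q :^ 2 :* G :^ 6 in
        x :* (h :* h :* h) :- :fromℕ 2 :* (d :* d) :* M :=
        :fromℕ 2 :* (C :^ 2 :* (Q :^ 8 :* G :^ 6)) :* (:fromℕ 2 :* Y :- M) :+
          (Q :^ 10 :* G :^ 12) :* (Y :* x :- :fromℕ 4 :* C :^ 2)) refl Q G C M x)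
      Yx≈4C²
      (*-nonNegative
        (*-nonNegative (fromℕ-nonNegative 2) (*-nonNegative 0≤C² (≤-trans 0≤1 (1≤* (1≤^ 1≤Q 8) (1≤^ 1≤G 6)))))
        (0≤y-x (≤-trans M≤Y (≤-by (solve 1 (λ Y → :fromℕ 2 :* Y :- Y := Y) refl Y) (≤-trans 0≤1 1≤Y)))))

    4d²≤xnh : fromℕ 4 * (d * d) ≤ x * (n * h)
    4d²≤xnh = ≤-by₁ {u = (C + fromℕ 3) * (Q ^ 8 * G ^ 6)}
      (solve 4 (λ Q G C x →
        let h = Q :^ 4 :* G :^ 6
            d = C :* (Q :^ 4 :* G :^ 3)
            n = (C :+ :fromℕ 3) :* (Q :^ 6 :* G :^ 6)
            Y = Q :^ 2 :* G :^ 6 in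
        x :* (n :* h) :- :fromℕ 4 :* (d :* d) :=
        :fromℕ 4 :* (C :^ 2 :* (Q :^ 8 :* G :^ 6)) :* (C :+ :fromℕ 2) :+
          (C :+ :fromℕ 3) :* (Q :^ 8 :* G :^ 6) :* (Y :* x :- :fromℕ 4 :* C :^ 2)) refl Q G C x)
      Yx≈4C²
      (*-nonNegative
        (*-nonNegative (fromℕ-nonNegative 4) (*-nonNegative 0≤C² (≤-trans 0≤1 (1≤* (1≤^ 1≤Q 8) (1≤^ 1≤G 6)))))
        (+-nonNegative 0≤C (fromℕ-nonNegative 2)))

    8Mx≤1 : fromℕ 8 * (M * x) ≤ 1#
    8Mx≤1 = *-cancelˡ-≤ (1≤⇒0< 1≤Y) (≤-by₁ {u = - (fromℕ 8 * M)}
      (solve 4 (λ Y C M x → Y :* :1 :- Y :* (:fromℕ 8 :* (M :* x)) :=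
        ((Y :- :fromℕ 64 :* C :^ 2 :* M) :+ :fromℕ 32 :* (C :^ 2 :* M)) :+
          (:- (:fromℕ 8 :* M)) :* (Y :* x :- :fromℕ 4 :* C :^ 2)) refl Y C M x)
      Yx≈4C²
      (+-nonNegative (0≤y-x 64C²M≤Q²G⁶) (*-nonNegative (fromℕ-nonNegative 32) (*-nonNegative 0≤C² 0≤M))))

    -- The gap is `(1 - ε) d - 2 ε h`, that is, `Q⁴ G³` times `(1 - ε) C - 2 ε G³`. The last term is
    -- at most 16, so 17 leaves a factor of at least 1.
    separated : ∀ {ε} → ε * G ^ 3 ≤ fromℕ 8 → fromℕ 17 ≤ (1# - ε) * C →
                (1# + ε) * h < (1# - ε) * (h + d)
    separated {ε} εG³≤8 17≤[1-ε]C = ≤-by refl (≤-trans (≤-trans 0≤1 1≤Q⁴G³) gap) ,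
      λ eq → <⇒≱ (1≤⇒0< 1≤Q⁴G³) (≤-respʳ (trans (+-congʳ (sym eq)) (-‿inverseʳ _)) gap)
      where
      gap : Q ^ 4 * G ^ 3 ≤ (1# - ε) * (h + d) - (1# + ε) * h
      gap = ≤-by (solve 4 (λ Q G C ε →
          let h = Q :^ 4 :* G :^ 6
              d = C :* (Q :^ 4 :* G :^ 3) in
          ((:1 :- ε) :* (h :+ d) :- (:1 :+ ε) :* h) :- Q :^ 4 :* G :^ 3 :=
          (Q :^ 4 :* G :^ 3) :* (((:1 :- ε) :* C :- :fromℕ 17) :+ :fromℕ 2 :* (:fromℕ 8 :- ε :* G :^ 3))) refl Q G C ε)
        (*-nonNegative (≤-trans 0≤1 1≤Q⁴G³) (+-nonNegative (0≤y-x 17≤[1-ε]C)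
          (*-nonNegative (fromℕ-nonNegative 2) (0≤y-x εG³≤8))))

-- The lower bound

module LowerBound {c ℓ₁ ℓ₂} (R : RealField c ℓ₁ ℓ₂) where
  open RealField R hiding (zero)
  open Hybrid R
  open OrderedField R
  open Parameters R
  open Exp semiring using (^-congˡ)
  open Min (DecTotalOrder.totalOrder decTotalOrder) using (x⊓y≤x; x⊓y≤y)

  -- Each case uses one side of the minimum. If `Q` is 1, then `n` itself has the required size;
  -- otherwise `ε` is at least `G⁻³`, so dividing by `∛ (ε ^ 4)` costs at most a factor `G⁴`.
  threshold-≤ : ∀ {n ε B Q G} → 1# ≤ B → 1# ≤ Q → 1# ≤ G →
    fromℕ n ≈ B * (Q ^ 6 * G ^ 6) → Q ≈ 1# ⊎ 1# ≤ ε * G ^ 3 →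
    threshold n ε ≤ B * (Q ^ 2 * G ^ 6)
  threshold-≤ {n} {ε} {B} {Q} {G} 1≤B 1≤Q 1≤G n≈ (inj₁ Q≈1) =
    ≤-trans (x⊓y≤y _ _) (≤-reflexive (trans n≈ (*-congˡ (*-congʳ (trans
      (solve 1 (λ Q → Q :^ 6 := Q :^ 2 :* Q :^ 4) refl Q)
      (trans (*-congˡ (^-congˡ 4 Q≈1)) (solve 1 (λ Q → Q :^ 2 :* :1 :^ 4 := Q :^ 2) refl Q)))))))
  threshold-≤ {n} {ε} {B} {Q} {G} 1≤B 1≤Q 1≤G n≈ (inj₂ 1≤εG³) =
    ≤-trans (x⊓y≤x _ _) (*-cancelˡ-≤ 0<t
      (≤-respˡ (trans (sym (*-identityʳ s)) (trans (*-congˡ (sym (⁻¹-inverse 0<t)))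
          (solve 3 (λ s t i → s :* (t :* i) := t :* (s :* i)) refl s t (t ⁻¹))))
        (≤-trans s≤ (≤-by
          (solve 4 (λ B Q G t → t :* (B :* (Q :^ 2 :* G :^ 6)) :- B :* (Q :^ 2 :* G :^ 2) :=
            B :* (Q :^ 2 :* G :^ 2) :* (G :^ 4 :* t :- :1)) refl B Q G t)
          (*-nonNegative 0≤BQ²G² (0≤y-x 1≤G⁴t))))))
    where
    s = ∛ (fromℕ n)
    t = ∛ (ε ^ 4)
    0≤BQ²G² : 0# ≤ B * (Q ^ 2 * G ^ 2)
    0≤BQ²G² = ≤-trans 0≤1 (1≤* 1≤B (1≤* (1≤^ 1≤Q 2) (1≤^ 1≤G 2)))
    -- `(G⁴ t)³ = (ε G³)⁴`.
    1≤G⁴t : 1# ≤ G ^ 4 * t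
    1≤G⁴t = cube-cancel-≤ 0<1 (≤-respʳ
      (trans (solve 2 (λ ε G → (ε :* G :^ 3) :^ 4 := (G :^ 4) :^ 3 :* ε :^ 4) refl ε G)
        (trans (*-congˡ (sym (∛-cubed (ε ^ 4))))
          (solve 2 (λ g t → g :^ 3 :* t :^ 3 := (g :* t) :^ 3) refl (G ^ 4) t)))
      (≤-respˡ (solve 0 (:1 := :1 :^ 3) refl) (1≤^ 1≤εG³ 4)))
    0<t : 0# < t
    0<t = *-cancelˡ-0≤ 0<G⁴ (≤-trans 0≤1 1≤G⁴t) ,
      λ 0≈t → <⇒≱ 0<1 (≤-respʳ (trans (*-congˡ (sym 0≈t)) (zeroʳ _)) 1≤G⁴t)
      where
      0<G⁴ : 0# < G ^ 4
      0<G⁴ = 1≤⇒0< (1≤^ 1≤G 4)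
    -- The cube of `s` is `B Q⁶ G⁶`, and `B ≤ B ^ 3`. The sign of `s` is settled first, since cubes
    -- are compared for a positive left side.
    s≤ : s ≤ B * (Q ^ 2 * G ^ 2)
    s≤ with s ≤? 0#
    ... | yes s≤0 = ≤-trans s≤0 0≤BQ²G²
    ... | no  s≰0 = cube-cancel-≤ (≰⇒> s≰0) (≤-respˡ (sym (trans (∛-cubed (fromℕ n)) n≈))
      (≤-respʳ (solve 3 (λ B Q G → B :^ 2 :* (B :* (Q :^ 6 :* G :^ 6)) := (B :* (Q :^ 2 :* G :^ 2)) :^ 3) refl B Q G)
        (1≤*-≤ (1≤^ 1≤B 2) (≤-trans 0≤1 (1≤* 1≤B (1≤* (1≤^ 1≤Q 6) (1≤^ 1≤G 6)))))))

  module _ {s m} (A : RandomizedAlgorithm s m) where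
    open RandomizedAlgorithm A

    -- The bound for deterministic algorithms is averaged over the internal randomness, which is the
    -- same for both instances; `4 (2/3 + 2/3) = 16/3` exceeds 5.
    ¬both-succeed : ∀ {n ε} {I₁ I₂ : Instance n} →
      (∀ (D : Algorithm m 0) →
        fromℕ 4 * (successProbability I₁ ε D [] + successProbability I₂ ε D []) ≤ fromℕ 5) →
      Succeeds A ε I₁ → ¬ Succeeds A ε I₂
    ¬both-succeed {n} {ε} {I₁} {I₂} bounded (int₁ , ⅔≤E₁) (int₂ , ⅔≤E₂) =
      <⇒≱ 0<1 (≤-by₁ {u = fromℕ 16}
        (solve 3 (λ E₁ E₂ i → :0 :- :1 :=
          ((:fromℕ 3 :* (:fromℕ 5 :- :fromℕ 4 :* (E₁ :+ E₂))) :+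
            :fromℕ 12 :* ((E₁ :- :fromℕ 2 :* i) :+ (E₂ :- :fromℕ 2 :* i))) :+
          (:fromℕ 16) :* (:fromℕ 3 :* i :- :1)) refl E₁ E₂ (fromℕ 3 ⁻¹))
        (⁻¹-inverse (fromℕ-positive 2))
        (+-nonNegative (*-nonNegative (fromℕ-nonNegative 3) (0≤y-x sum≤5))
          (*-nonNegative (fromℕ-nonNegative 12) (+-nonNegative (0≤y-x ⅔≤E₁) (0≤y-x ⅔≤E₂)))))
      where
      success₁ success₂ : Ω → Carrier
      success₁ ω = successProbability I₁ ε (run ω) []
      success₂ ω = successProbability I₂ ε (run ω) []
      E₁ = 𝔼 success₁
      E₂ = 𝔼 success₂
      int₁₂ = +-integrable int₁ int₂
      sum≤5 : fromℕ 4 * (E₁ + E₂) ≤ fromℕ 5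
      sum≤5 = ≤-respˡ (trans (𝔼-* (fromℕ 4) int₁₂) (*-congˡ (𝔼-+ int₁ int₂)))
        (≤-respʳ (𝔼-const (fromℕ 5))
          (𝔼-mono (*-integrable (fromℕ 4) int₁₂) (const-integrable (fromℕ 5)) (λ ω → bounded (run ω))))

  module _ {s} {n q G C m : ℕ} {ε : Carrier} (A : RandomizedAlgorithm s m)
    (succeeds : ∀ (I : Instance n) → Succeeds A ε I)
    (1≤q : 1 ℕ.≤ q) (1≤G : 1 ℕ.≤ G) (1≤C : 1 ℕ.≤ C)
    (n≈ : fromℕ n ≈ (fromℕ C + fromℕ 3) * (fromℕ q ^ 6 * fromℕ G ^ 6))
    (64C²m≤q²G⁶ : fromℕ 64 * fromℕ C ^ 2 * fromℕ m ≤ fromℕ q ^ 2 * fromℕ G ^ 6)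
    (εG³≤8 : ε * fromℕ G ^ 3 ≤ fromℕ 8)
    (17≤[1-ε]C : fromℕ 17 ≤ (1# - ε) * fromℕ C)
    where

    few-samples-fail : ⊥
    few-samples-fail = ¬both-succeed A success-sum (succeeds I₁) (succeeds I₂)
      where
      h d z : ℕ
      h = q ℕ.^ 4 ℕ.* G ℕ.^ 6
      d = C ℕ.* (q ℕ.^ 4 ℕ.* G ℕ.^ 3)
      -- The truncation never takes effect: `h+d≤n` is pulled back from the field below.
      z = n ℕ.∸ (h ℕ.+ d)

      Q′ G′ C′ M′ : Carrier
      Q′ = fromℕ q
      G′ = fromℕ G
      C′ = fromℕ C
      M′ = fromℕ m

      1≤Q = 1≤fromℕ 1≤q
      1≤G′ = 1≤fromℕ 1≤G
      1≤C′ = 1≤fromℕ 1≤C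
      0≤M = fromℕ-nonNegative m

      open Scale 1≤Q 1≤G′ 1≤C′ 0≤M 64C²m≤q²G⁶

      fromℕ-*-^ : ∀ k l → fromℕ (q ℕ.^ k ℕ.* G ℕ.^ l) ≈ Q′ ^ k * G′ ^ l
      fromℕ-*-^ k l = trans (fromℕ-* (q ℕ.^ k) (G ℕ.^ l)) (*-cong (fromℕ-^ q k) (fromℕ-^ G l))

      h≈ : fromℕ h ≈ Q′ ^ 4 * G′ ^ 6
      h≈ = fromℕ-*-^ 4 6

      d≈ : fromℕ d ≈ C′ * (Q′ ^ 4 * G′ ^ 3)
      d≈ = trans (fromℕ-* C (q ℕ.^ 4 ℕ.* G ℕ.^ 3)) (*-congˡ (fromℕ-*-^ 4 3))

      2h+d+m≤n : Q′ ^ 4 * G′ ^ 6 + M′ + (fromℕ h + fromℕ d) ≤ fromℕ n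
      2h+d+m≤n = ≤-respˡ (+-congˡ (+-cong (sym h≈) (sym d≈))) (≤-respʳ (sym n≈)
        2h+d+M≤n)

      h+d≤n : h ℕ.+ d ℕ.≤ n
      h+d≤n = fromℕ-cancel-≤ (≤-respˡ (trans (+-identityˡ _) (sym (fromℕ-+ h d)))
        (≤-trans (+-mono-≤ (+-nonNegative (proj₁ 0<h) 0≤M) ≤-refl) 2h+d+m≤n))

      h+[d+z]≡n : h ℕ.+ (d ℕ.+ z) ≡ n
      h+[d+z]≡n = ≡.trans (≡.sym (ℕ.+-assoc h d z)) (ℕ.m+[n∸m]≡n h+d≤n)

      n≈h+d+z : fromℕ n ≈ fromℕ h + fromℕ d + fromℕ z
      n≈h+d+z = trans (reflexive (≡.cong fromℕ (≡.sym (ℕ.m+[n∸m]≡n h+d≤n))))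
        (trans (fromℕ-+ (h ℕ.+ d) z) (+-congʳ (fromℕ-+ h d)))

      h+m≤z : Q′ ^ 4 * G′ ^ 6 + M′ ≤ fromℕ z
      h+m≤z = ≤-by₁ {u = 1#}
        (solve 5 (λ k h d z n → z :- k := (n :- (k :+ (h :+ d))) :+ :1 :* ((h :+ d :+ z) :- n))
          refl (Q′ ^ 4 * G′ ^ 6 + M′) (fromℕ h) (fromℕ d) (fromℕ z) (fromℕ n))
        (sym n≈h+d+z) (0≤y-x 2h+d+m≤n)

      -- Stated for a separate `n`, so that the equation can be matched with `refl` although `z`
      -- depends on the given one.
      sum-kind : ∀ {n} → h ℕ.+ (d ℕ.+ z) ≡ n → ∀ u v w → sum {n} (pickKind u v w ∘ blocks h d) ≈
        u * (Q′ ^ 4 * G′ ^ 6) + (v * (C′ * (Q′ ^ 4 * G′ ^ 3)) + w * fromℕ z)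
      sum-kind ≡.refl u v w = trans (sum-blocks h d z u v w)
        (+-cong (*-congˡ h≈) (+-congʳ (*-congˡ d≈)))

      open TwoPoint.Instances R {n} (blocks h d) _ _ (fromℕ z) _ ε m (sum-kind h+[d+z]≡n)
        0<h
        0≤d
        0≤x
        2M≤h
        h+m≤z
        2d²M≤xh³
        (≤-respʳ (*-congˡ (*-congʳ (sym n≈))) 4d²≤xnh)
        8Mx≤1
        (separated εG³≤8 17≤[1-ε]C)
        using (I₁; I₂; success-sum)

theorem18 : ∀ {c ℓ₁ ℓ₂ s} (R : RealField c ℓ₁ ℓ₂) →
    let open RealField R
        open Hybrid R in
    (ε : ℕ → Carrier) (ε₀ : Carrier) →
    ε₀ < 1# →
    (∀ n → 0# < ε n × ε n ≤ ε₀) →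
    (m : ℕ → ℕ) →
    (λ n → fromℕ (m n)) =o (λ n → threshold n (ε n)) →
    ¬ (Σ[ A ∈ ((n : ℕ) → RandomizedAlgorithm s (m n)) ]
         (∀ n (I : Instance n) → Succeeds (A n) (ε n) I))
theorem18 R ε ε₀ (ε₀≤1 , ε₀≉1) ε-bounds m m=o (A , succeeds) = contradiction (dyadic-scale ε≤1 r)
  where
  open RealField R
  open Hybrid R
  open OrderedField R
  open Parameters R
  open LowerBound R

  0<1-ε₀ : 0# < 1# - ε₀
  0<1-ε₀ = 0≤y-x ε₀≤1 , λ 0≈1-ε₀ → ε₀≉1 (sym (≈-by₀ (sym 0≈1-ε₀)))

  -- The uniform gap between `ε₀` and 1 lets one constant `C` serve all `ε n`.
  large : ∃[ C ] 1 ℕ.≤ C × fromℕ 17 ≤ (1# - ε₀) * fromℕ C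
  large = archimedean-multiple 0<1-ε₀ (fromℕ 17)

  C : ℕ
  C = proj₁ large

  1≤C : 1 ℕ.≤ C
  1≤C = proj₁ (proj₂ large)

  C′ B Δ δ : Carrier
  C′ = fromℕ C
  B = C′ + fromℕ 3
  Δ = fromℕ 64 * C′ ^ 2
  -- With the threshold at most `B Y`, this makes `Δ m ≤ Y`, and `Δ` is the factor that the choice
  -- of scale demands.
  δ = (B * Δ) ⁻¹

  1≤C′ : 1# ≤ C′
  1≤C′ = 1≤fromℕ 1≤C

  1≤B : 1# ≤ B
  1≤B = ≤-respˡ (+-identityʳ 1#) (+-mono-≤ 1≤C′ (fromℕ-nonNegative 3))

  0<B : 0# < B
  0<B = 1≤⇒0< 1≤B

  0<BΔ : 0# < B * Δ
  0<BΔ = *-positive 0<B (*-positive (fromℕ-positive 63) (1≤⇒0< (1≤^ 1≤C′ 2)))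

  -- The index from which the little-o bound holds serves as the exponent: then `n ≥ 2 ^ r ≥ r`, so
  -- the bound holds at this `n`, and `Q G = 2 ^ r`.
  r : ℕ
  r = proj₁ (m=o δ (⁻¹-positive 0<BΔ))

  n : ℕ
  n = (C ℕ.+ 3) ℕ.* (2 ℕ.^ r) ℕ.^ 6

  r≤n : r ℕ.≤ n
  r≤n = ℕ.≤-trans (n≤2^n r) (ℕ.≤-trans
    (ℕ.m≤m*n (2 ℕ.^ r) ((2 ℕ.^ r) ℕ.^ 5) {{ℕ.m^n≢0 (2 ℕ.^ r) 5 {{ℕ.m^n≢0 2 r}}}})
    (ℕ.m≤n*m ((2 ℕ.^ r) ℕ.^ 6) (C ℕ.+ 3) {{ℕ.>-nonZero (ℕ.≤-trans 1≤C (ℕ.m≤m+n C 3))}}))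

  ε≤1 : ε n ≤ 1#
  ε≤1 = ≤-trans (proj₂ (ε-bounds n)) ε₀≤1

  contradiction : ¬ (∃[ q ] ∃[ G ] q ℕ.* G ≡ 2 ℕ.^ r × 1 ℕ.≤ q × 1 ℕ.≤ G ×
    ε n * fromℕ G ^ 3 ≤ fromℕ 8 × (q ≡ 1 ⊎ 1# ≤ ε n * fromℕ G ^ 3))
  contradiction (q , G , qG≡2^r , 1≤q , 1≤G , εG³≤8 , cut) = few-samples-fail (A n) (succeeds n) 1≤q 1≤G 1≤C n≈
      (*-cancelˡ-≤ 0<B BΔm≤BY) εG³≤8
      (≤-trans (proj₂ (proj₂ large)) (≤-by
        (solve 3 (λ ε ε₀ C → (:1 :- ε) :* C :- (:1 :- ε₀) :* C := C :* (ε₀ :- ε)) refl (ε n) ε₀ C′)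
        (*-nonNegative (≤-trans 0≤1 1≤C′) (0≤y-x (proj₂ (ε-bounds n))))))
    where
    Q G′ Y : Carrier
    Q = fromℕ q
    G′ = fromℕ G
    Y = Q ^ 2 * G′ ^ 6

    n≈ : fromℕ n ≈ B * (Q ^ 6 * G′ ^ 6)
    n≈ = trans (fromℕ-* (C ℕ.+ 3) ((2 ℕ.^ r) ℕ.^ 6)) (*-cong (fromℕ-+ C 3)
      (trans (reflexive (≡.cong (λ k → fromℕ (k ℕ.^ 6)) (≡.sym qG≡2^r)))
        (trans (fromℕ-^ (q ℕ.* G) 6) (trans (^-congˡ 6 (fromℕ-* q G))
          (solve 2 (λ Q G → (Q :* G) :^ 6 := Q :^ 6 :* G :^ 6) refl Q G′)))))
      where open Exp semiring using (^-congˡ)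

    cut′ : Q ≈ 1# ⊎ 1# ≤ ε n * G′ ^ 3
    cut′ = map₁ (λ q≡1 → trans (reflexive (≡.cong fromℕ q≡1)) (+-identityʳ 1#)) cut

    BΔm≤BY : B * (Δ * fromℕ (m n)) ≤ B * Y
    BΔm≤BY = ≤-trans
      (≤-by₁ {u = threshold n (ε n)}
        (solve 5 (λ B Δ δ M T → T :- B :* (Δ :* M) := B :* Δ :* (δ :* T :- M) :+ T :* (:1 :- B :* Δ :* δ))
          refl B Δ δ (fromℕ (m n)) (threshold n (ε n)))
        (sym (⁻¹-inverse 0<BΔ))
        (*-nonNegative (proj₁ 0<BΔ) (0≤y-x (proj₂ (m=o δ (⁻¹-positive 0<BΔ)) n r≤n))))
      (threshold-≤ {n} {ε n} {B} {Q} {G′} 1≤B (1≤fromℕ 1≤q) (1≤fromℕ 1≤G) n≈ cut′)
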